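{- Let $k$ be a field, let $g$ and $d$ be natural numbers, and suppose that $M\in\mathrm{Rep}_k(\mathcal{G}_g^{\mathrm{op}})$ is $d$-smallish. Then there exists a polynomial $f_M(t)\in\mathbb{Z}[t]$ of degree at most $d$ such that, for all graphs $G$ of genus $g$, $$\dim_k M(G)\le f_M(|G|).$$
   Context: A graph is a finite CW complex of dimension at most 1; 0-cells are vertices, 1-cells are edges (loops and multiple edges allowed); $|G|$ is the number of edges of $G$. The genus of a non-empty connected graph is the rank of its first homology; a "graph of genus $g$" is always non-empty and connected. A map of CW complexes between graphs is very cellular if it takes every vertex to a vertex and every edge to either a vertex or an edge. A graph morphism is an equivalence class of very cellular maps under homotopy through very cellular maps. A contraction is a surjective graph morphism with contractible fibers (it amounts to collapsing a set of edges forming a forest, followed by a graph isomorphism). $\mathcal{G}_g$ is the category of graphs of genus $g$ with contractions as morphisms, and $\mathrm{Rep}_k(\mathcal{G}_g^{\mathrm{op}})$ is the category of functors from $\mathcal{G}_g^{\mathrm{op}}$ to $k$-modules. $M$ is finitely generated in degrees $\le d$ if there are finitely many graphs $G_1,\dots,G_r$ of genus $g$, each with at most $d$ edges, and elements $v_i\in M(G_i)$ such that for every $G$, $M(G)$ is spanned by the images of the $v_i$ under the maps $M(G_i)\to M(G)$ induced by all contractions $G\to G_i$. $M$ is $d$-small if it is a subquotient of a module that is finitely generated in degrees $\le d$, and $d$-smallish if it admits a (finite) filtration by submodules, $0=M_0\subset M_1\subset\dots\subset M_m=M$, whose associated graded module is $d$-small. -}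

module Defs where

open import Algebra.Apartness.Bundles using (HeytingField; HeytingCommutativeRing)
open import Algebra.Bundles using (CommutativeMonoid; CommutativeRing; Ring)
import Algebra.Definitions.RawMonoid
open import Algebra.Module.Bundles using (LeftModule)
import Algebra.Module.Construct.TensorUnit as TensorUnit
open import Algebra.Module.Morphism.Structures using (module LeftModuleMorphisms)
import Algebra.Properties.AbelianGroup
import Algebra.Properties.CommutativeSemigroup
import Algebra.Properties.Semiring.Sum
open import Data.Bool.Base using (if_then_else_)
open import Data.Empty using (⊥-elim)
open import Data.Fin.Base using (Fin; zero; suc; inject₁; fromℕ)
open import Data.Fin.Properties using (_≟_; suc-injective)
open import Data.Integer.Base as ℤ using (ℤ; +_; 0ℤ; 1ℤ; -1ℤ)
import Data.Integer.Properties as ℤ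
open import Data.Nat.Base as ℕ using (ℕ; zero; suc)
open import Data.Product using (Σ; Σ-syntax; ∃; ∃-syntax; ∃!; _×_; _,_; proj₁; proj₂)
open import Data.Sign.Base using (Sign; opposite) renaming (_*_ to _*ˢ_)
open import Data.Sum.Base using (_⊎_; inj₁; inj₂)
open import Data.Vec.Base using (Vec; foldr′)
open import Data.Unit.Base using (tt)
open import Function.Base using (_∘_; id)
open import Level using (Level; 0ℓ; _⊔_) renaming (suc to lsuc)
open import Relation.Binary.Construct.Closure.Equivalence using (EqClosure; gmap; symmetric)
open import Relation.Binary.Construct.Closure.ReflexiveTransitive using (ε; _◅_; _◅◅_)
open import Relation.Binary.Construct.Closure.Symmetric using (fwd; bwd)
open import Relation.Binary.PropositionalEquality.Core using (_≡_; _≢_; refl; sym; trans; cong; cong₂)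
open import Relation.Binary.PropositionalEquality.Properties using (module ≡-Reasoning)
import Relation.Binary.Reasoning.Setoid
open import Relation.Nullary using (¬_; yes; no; does)
open import Relation.Unary using (Pred; U)

module _ {r ℓr : Level} {R : Ring r ℓr} {m ℓm : Level} (M : LeftModule R m ℓm) where

  open LeftModule M
  open Ring R using (Carrier; _≈_; 0#)

  combination : {n : ℕ} → (Fin n → Carrier) → (Fin n → Carrierᴹ) → Carrierᴹ
  combination c v = sum (λ j → c j *ₗ v j)
    where open Algebra.Definitions.RawMonoid +ᴹ-rawMonoid using (sum)

  _∈Span_ : {i : Level} {I : Set i} → Carrierᴹ → (I → Carrierᴹ) → Set (r ⊔ ℓm ⊔ i)
  _∈Span_ {I = I} x f =
    ∃[ n ] Σ[ j ∈ (Fin n → I) ] Σ[ c ∈ (Fin n → Carrier) ] x ≈ᴹ combination c (f ∘ j)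

  record IsBasis {n : ℕ} (b : Fin n → Carrierᴹ) : Set (r ⊔ ℓr ⊔ m ⊔ ℓm) where
    field
      independent : ∀ c → combination c b ≈ᴹ 0ᴹ → ∀ j → c j ≈ 0#
      spanning    : ∀ x → Σ[ c ∈ (Fin n → Carrier) ] x ≈ᴹ combination c b

  -- Over a field: dim M = n.  Constructively, a subquotient of a finite-dimensional
  -- space need not have a basis, so bounds on dim M are stated under ¬ ¬.
  HasRank : ℕ → Set (r ⊔ ℓr ⊔ m ⊔ ℓm)
  HasRank n = Σ[ b ∈ (Fin n → Carrierᴹ) ] IsBasis b

  record Submodule (p : Level) : Set (r ⊔ m ⊔ ℓm ⊔ lsuc p) where
    field
      Member    : Pred Carrierᴹ p
      resp      : ∀ {x y} → x ≈ᴹ y → Member x → Member y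
      0ᴹ-closed : Member 0ᴹ
      +ᴹ-closed : ∀ {x y} → Member x → Member y → Member (x +ᴹ y)
      -ᴹ-closed : ∀ {x} → Member x → Member (-ᴹ x)
      *ₗ-closed : ∀ a {x} → Member x → Member (a *ₗ x)

open Submodule using (Member)

module _ {r ℓr : Level} {R : Ring r ℓr} where

  infix 4 _⊆_
  infixl 7 _/_

  _⊆_ : ∀ {m ℓm p : Level} {M : LeftModule R m ℓm} → Submodule M p → Submodule M p → Set (m ⊔ p)
  Q ⊆ P = ∀ {x} → Member Q x → Member P x

  ≈ᴹ⇒difference : ∀ {m ℓm p : Level} {M : LeftModule R m ℓm} (Q : Submodule M p) {x y : LeftModule.Carrierᴹ M} →
    LeftModule._≈ᴹ_ M x y → Member Q (LeftModule._+ᴹ_ M x (LeftModule.-ᴹ_ M y))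
  ≈ᴹ⇒difference {M = M} Q {x} {y} eq =
    resp (≈ᴹ-sym (≈ᴹ-trans (+ᴹ-congʳ eq) (-ᴹ‿inverseʳ y))) 0ᴹ-closed
    where
    open LeftModule M
    open Submodule Q

  -- Used only when Q ⊆ P.
  _/_ : ∀ {m ℓm p : Level} {M : LeftModule R m ℓm} →
        Submodule M p → Submodule M p → LeftModule R (m ⊔ p) p
  _/_ {M = M} P Q = record
    { Carrierᴹ = Σ Carrierᴹ (Member P)
    ; _≈ᴹ_ = λ (x , _) (y , _) → Member Q (x +ᴹ -ᴹ y)
    ; _+ᴹ_ = λ (x , p) (y , q) → x +ᴹ y , P.+ᴹ-closed p q
    ; _*ₗ_ = λ a (x , p) → a *ₗ x , P.*ₗ-closed a p
    ; 0ᴹ = 0ᴹ , P.0ᴹ-closed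
    ; -ᴹ_ = λ (x , p) → -ᴹ x , P.-ᴹ-closed p
    ; isLeftModule = record
      { isLeftSemimodule = record
        { +ᴹ-isCommutativeMonoid = record
          { isMonoid = record
            { isSemigroup = record
              { isMagma = record
                { isEquivalence = record
                  { refl  = lift ≈ᴹ-refl
                  ; sym   = λ q → Q.resp (-‿diff _ _) (Q.-ᴹ-closed q)
                  ; trans = λ q q′ → Q.resp (diff-trans _ _ _) (Q.+ᴹ-closed q q′)
                  }
                ; ∙-cong = λ q q′ → Q.resp (diff-+ _ _ _ _) (Q.+ᴹ-closed q q′)
                }
              ; assoc = λ _ _ _ → lift (+ᴹ-assoc _ _ _)
              }
            ; identity = (λ _ → lift (+ᴹ-identityˡ _)) , (λ _ → lift (+ᴹ-identityʳ _))
            }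
          ; comm = λ _ _ → lift (+ᴹ-comm _ _)
          }
        ; isPreleftSemimodule = record
          { *ₗ-cong      = λ a≈b q → Q.resp (diff-* a≈b _ _) (Q.*ₗ-closed _ q)
          ; *ₗ-zeroˡ     = λ _ → lift (*ₗ-zeroˡ _)
          ; *ₗ-distribʳ  = λ _ _ _ → lift (*ₗ-distribʳ _ _ _)
          ; *ₗ-identityˡ = λ _ → lift (*ₗ-identityˡ _)
          ; *ₗ-assoc     = λ _ _ _ → lift (*ₗ-assoc _ _ _)
          ; *ₗ-zeroʳ     = λ _ → lift (*ₗ-zeroʳ _)
          ; *ₗ-distribˡ  = λ _ _ _ → lift (*ₗ-distribˡ _ _ _)
          }
        }
      ; -ᴹ‿cong    = λ q → Q.resp (≈ᴹ-sym (⁻¹-∙-comm _ _)) (Q.-ᴹ-closed q)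
      ; -ᴹ‿inverse = (λ _ → lift (-ᴹ‿inverseˡ _)) , (λ _ → lift (-ᴹ‿inverseʳ _))
      }
    }
    where
    open LeftModule M
    module P = Submodule P
    module Q = Submodule Q
    open Algebra.Properties.AbelianGroup +ᴹ-abelianGroup using (⁻¹-∙-comm; ⁻¹-involutive; inverseʳ-unique)
    open Algebra.Properties.CommutativeSemigroup
      (CommutativeMonoid.commutativeSemigroup +ᴹ-commutativeMonoid) using (interchange)
    open Relation.Binary.Reasoning.Setoid ≈ᴹ-setoid

    lift : ∀ {x y} → x ≈ᴹ y → Member Q (x +ᴹ -ᴹ y)
    lift = ≈ᴹ⇒difference Q

    -‿diff : ∀ x y → -ᴹ (x +ᴹ -ᴹ y) ≈ᴹ y +ᴹ -ᴹ x
    -‿diff x y = begin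
      -ᴹ (x +ᴹ -ᴹ y)       ≈⟨ ⁻¹-∙-comm x (-ᴹ y) ⟨
      -ᴹ x +ᴹ -ᴹ (-ᴹ y)    ≈⟨ +ᴹ-congˡ (⁻¹-involutive y) ⟩
      -ᴹ x +ᴹ y            ≈⟨ +ᴹ-comm _ _ ⟩
      y +ᴹ -ᴹ x            ∎

    diff-trans : ∀ x y z → (x +ᴹ -ᴹ y) +ᴹ (y +ᴹ -ᴹ z) ≈ᴹ x +ᴹ -ᴹ z
    diff-trans x y z = begin
      (x +ᴹ -ᴹ y) +ᴹ (y +ᴹ -ᴹ z)  ≈⟨ +ᴹ-assoc _ _ _ ⟩
      x +ᴹ (-ᴹ y +ᴹ (y +ᴹ -ᴹ z))  ≈⟨ +ᴹ-congˡ (+ᴹ-assoc _ _ _) ⟨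
      x +ᴹ ((-ᴹ y +ᴹ y) +ᴹ -ᴹ z)  ≈⟨ +ᴹ-congˡ (+ᴹ-congʳ (-ᴹ‿inverseˡ y)) ⟩
      x +ᴹ (0ᴹ +ᴹ -ᴹ z)           ≈⟨ +ᴹ-congˡ (+ᴹ-identityˡ _) ⟩
      x +ᴹ -ᴹ z                   ∎

    diff-+ : ∀ x y u v → (x +ᴹ -ᴹ y) +ᴹ (u +ᴹ -ᴹ v) ≈ᴹ (x +ᴹ u) +ᴹ -ᴹ (y +ᴹ v)
    diff-+ x y u v = ≈ᴹ-trans (interchange x (-ᴹ y) u (-ᴹ v)) (+ᴹ-congˡ (⁻¹-∙-comm y v))

    *ₗ-neg : ∀ a x → a *ₗ (-ᴹ x) ≈ᴹ -ᴹ (a *ₗ x)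
    *ₗ-neg a x = inverseʳ-unique (a *ₗ x) (a *ₗ (-ᴹ x)) (begin
      a *ₗ x +ᴹ a *ₗ (-ᴹ x)   ≈⟨ *ₗ-distribˡ a x (-ᴹ x) ⟨
      a *ₗ (x +ᴹ -ᴹ x)        ≈⟨ *ₗ-congˡ (-ᴹ‿inverseʳ x) ⟩
      a *ₗ 0ᴹ                 ≈⟨ *ₗ-zeroʳ a ⟩
      0ᴹ                      ∎)

    diff-* : ∀ {a b} → Ring._≈_ R a b → ∀ x y → a *ₗ (x +ᴹ -ᴹ y) ≈ᴹ a *ₗ x +ᴹ -ᴹ (b *ₗ y)
    diff-* {a} {b} a≈b x y = begin
      a *ₗ (x +ᴹ -ᴹ y)         ≈⟨ *ₗ-distribˡ a x (-ᴹ y) ⟩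
      a *ₗ x +ᴹ a *ₗ (-ᴹ y)    ≈⟨ +ᴹ-congˡ (*ₗ-neg a y) ⟩
      a *ₗ x +ᴹ -ᴹ (a *ₗ y)    ≈⟨ +ᴹ-congˡ (-ᴹ‿cong (*ₗ-congʳ a≈b)) ⟩
      a *ₗ x +ᴹ -ᴹ (b *ₗ y)    ∎

  ⨁ : ∀ {m ℓm : Level} {n : ℕ} → (Fin n → LeftModule R m ℓm) → LeftModule R m ℓm
  ⨁ {n = n} M = record
    { Carrierᴹ = (i : Fin n) → Carrierᴹ (M i)
    ; _≈ᴹ_ = λ x y → ∀ i → _≈ᴹ_ (M i) (x i) (y i)
    ; _+ᴹ_ = λ x y i → _+ᴹ_ (M i) (x i) (y i)
    ; _*ₗ_ = λ a x i → _*ₗ_ (M i) a (x i)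
    ; 0ᴹ = λ i → 0ᴹ (M i)
    ; -ᴹ_ = λ x i → -ᴹ_ (M i) (x i)
    ; isLeftModule = record
      { isLeftSemimodule = record
        { +ᴹ-isCommutativeMonoid = record
          { isMonoid = record
            { isSemigroup = record
              { isMagma = record
                { isEquivalence = record
                  { refl  = λ i → ≈ᴹ-refl (M i)
                  ; sym   = λ p i → ≈ᴹ-sym (M i) (p i)
                  ; trans = λ p q i → ≈ᴹ-trans (M i) (p i) (q i)
                  }
                ; ∙-cong = λ p q i → +ᴹ-cong (M i) (p i) (q i)
                }
              ; assoc = λ _ _ _ i → +ᴹ-assoc (M i) _ _ _
              }
            ; identity = (λ _ i → +ᴹ-identityˡ (M i) _) , (λ _ i → +ᴹ-identityʳ (M i) _)
            }
          ; comm = λ _ _ i → +ᴹ-comm (M i) _ _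
          }
        ; isPreleftSemimodule = record
          { *ₗ-cong      = λ p q i → *ₗ-cong (M i) p (q i)
          ; *ₗ-zeroˡ     = λ _ i → *ₗ-zeroˡ (M i) _
          ; *ₗ-distribʳ  = λ _ _ _ i → *ₗ-distribʳ (M i) _ _ _
          ; *ₗ-identityˡ = λ _ i → *ₗ-identityˡ (M i) _
          ; *ₗ-assoc     = λ _ _ _ i → *ₗ-assoc (M i) _ _ _
          ; *ₗ-zeroʳ     = λ _ i → *ₗ-zeroʳ (M i) _
          ; *ₗ-distribˡ  = λ _ _ _ i → *ₗ-distribˡ (M i) _ _ _
          }
        }
      ; -ᴹ‿cong    = λ p i → -ᴹ‿cong (M i) (p i)
      ; -ᴹ‿inverse = (λ _ i → -ᴹ‿inverseˡ (M i) _) , (λ _ i → -ᴹ‿inverseʳ (M i) _)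
      }
    }
    where open LeftModule

-- The orientation src → tgt of each edge is an auxiliary choice:
-- contractions may reverse it.
record Graph : Set where
  field
    V E     : ℕ
    src tgt : Fin E → Fin V

open Graph

∣_∣ : Graph → ℕ
∣ G ∣ = E G

record Subgraph (G : Graph) : Set₁ where
  field
    vertex : Pred (Fin (V G)) 0ℓ
    edge   : Pred (Fin (E G)) 0ℓ
    closed : ∀ {e} → edge e → vertex (src G e) × vertex (tgt G e)

whole : (G : Graph) → Subgraph G
whole G = record { vertex = U ; edge = U ; closed = λ _ → tt , tt }

Adjacent : {G : Graph} → Subgraph G → Fin (V G) → Fin (V G) → Set
Adjacent {G} S u v = ∃[ e ] (Subgraph.edge S e × src G e ≡ u × tgt G e ≡ v)

open Algebra.Properties.Semiring.Sum ℤ.+-*-semiring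

ℤ-ring : Ring 0ℓ 0ℓ
ℤ-ring = CommutativeRing.ring ℤ.+-*-commutativeRing

δ : {n : ℕ} → Fin n → Fin n → ℤ
δ i j = if does (i ≟ j) then 1ℤ else 0ℤ

C₁ : Graph → LeftModule ℤ-ring 0ℓ 0ℓ
C₁ G = ⨁ {n = E G} (λ _ → TensorUnit.leftModule {R = ℤ-ring})

-- The coefficient of the vertex v in the cellular boundary Σₑ cₑ (tgt e - src e).
∂ : (G : Graph) → (Fin (E G) → ℤ) → Fin (V G) → ℤ
∂ G c v = ∑[ e < E G ] (c e ℤ.* (δ (tgt G e) v ℤ.- δ (src G e) v))

record IsCycle {G : Graph} (S : Subgraph G) (c : Fin (E G) → ℤ) : Set where
  field
    boundary : ∀ v → ∂ G c v ≡ 0ℤ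
    support  : ∀ e → ¬ Subgraph.edge S e → c e ≡ 0ℤ

open IsCycle

module ℤ-lemmas where

  sum-zero : ∀ {n} (t : Fin n → ℤ) → (∀ i → t i ≡ 0ℤ) → sum t ≡ 0ℤ
  sum-zero {n} t z = trans (sum-cong-≗ z) (sum-replicate-zero n)

  sum-single : ∀ {n} (t : Fin n → ℤ) i → (∀ j → j ≢ i → t j ≡ 0ℤ) → sum t ≡ t i
  sum-single t zero z =
    trans (cong (ℤ._+_ (t zero)) (sum-zero (t ∘ suc) (λ j → z (suc j) (λ ())))) (ℤ.+-identityʳ _)
  sum-single t (suc i) z =
    trans (cong₂ ℤ._+_ (z zero (λ ()))
            (sum-single (t ∘ suc) i (λ j j≢i → z (suc j) (j≢i ∘ suc-injective))))
          (ℤ.+-identityˡ _)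

  δ-refl : ∀ {n} (i : Fin n) → δ i i ≡ 1ℤ
  δ-refl i with i ≟ i
  ... | yes _  = refl
  ... | no i≢i = ⊥-elim (i≢i refl)

  δ-≢ : ∀ {n} {i j : Fin n} → i ≢ j → δ i j ≡ 0ℤ
  δ-≢ {i = i} {j} i≢j with i ≟ j
  ... | yes i≡j = ⊥-elim (i≢j i≡j)
  ... | no _    = refl

  δ-sum : ∀ {n} (i : Fin n) (h : Fin n → ℤ) → ∑[ j < n ] (δ i j ℤ.* h j) ≡ h i
  δ-sum i h = trans
    (sum-single _ i (λ j j≢i → cong (ℤ._* h j) (δ-≢ (j≢i ∘ sym))))
    (trans (cong (ℤ._* h i) (δ-refl i)) (ℤ.*-identityˡ _))

  neg-sum : ∀ {n} (t : Fin n → ℤ) → ∑[ j < n ] (ℤ.- t j) ≡ ℤ.- sum t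
  neg-sum {n} t = trans (sum-cong-≗ (λ j → sym (ℤ.-1*i≡-i (t j))))
    (trans (sym (*-distribˡ-sum -1ℤ t)) (ℤ.-1*i≡-i (sum t)))

  sub-sum : ∀ {n} (s t : Fin n → ℤ) → ∑[ j < n ] (s j ℤ.- t j) ≡ sum s ℤ.- sum t
  sub-sum s t = trans (∑-distrib-+ s (λ j → ℤ.- t j)) (cong (ℤ._+_ (sum s)) (neg-sum t))

  *-distribʳ-minus : ∀ a b c → (a ℤ.- b) ℤ.* c ≡ a ℤ.* c ℤ.- b ℤ.* c
  *-distribʳ-minus a b c = trans (ℤ.*-distribʳ-+ c a (ℤ.- b))
    (cong (ℤ._+_ (a ℤ.* c)) (sym (ℤ.neg-distribˡ-* b c)))

  *-distribˡ-minus : ∀ a b c → a ℤ.* (b ℤ.- c) ≡ a ℤ.* b ℤ.- a ℤ.* c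
  *-distribˡ-minus a b c = trans (ℤ.*-distribˡ-+ a b (ℤ.- c))
    (cong (ℤ._+_ (a ℤ.* b)) (sym (ℤ.neg-distribʳ-* a c)))

  neg-minus : ∀ a b → ℤ.- (a ℤ.- b) ≡ b ℤ.- a
  neg-minus a b = trans (ℤ.neg-distrib-+ a (ℤ.- b))
    (trans (cong (ℤ._+_ (ℤ.- a)) (ℤ.neg-involutive b)) (ℤ.+-comm (ℤ.- a) b))

  δ-diff : ∀ {n} (i j : Fin n) (h : Fin n → ℤ) →
    ∑[ k < n ] ((δ i k ℤ.- δ j k) ℤ.* h k) ≡ h i ℤ.- h j
  δ-diff i j h = trans (sum-cong-≗ (λ k → *-distribʳ-minus (δ i k) (δ j k) (h k)))
    (trans (sub-sum (λ k → δ i k ℤ.* h k) (λ k → δ j k ℤ.* h k))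
           (cong₂ ℤ._-_ (δ-sum i h) (δ-sum j h)))

  swap-sum : ∀ {m n} (c : Fin m → ℤ) (a : Fin m → Fin n → ℤ) (h : Fin n → ℤ) →
    ∑[ j < n ] ((∑[ i < m ] (c i ℤ.* a i j)) ℤ.* h j)
      ≡ ∑[ i < m ] (c i ℤ.* (∑[ j < n ] (a i j ℤ.* h j)))
  swap-sum {m} {n} c a h = begin
    ∑[ j < n ] ((∑[ i < m ] (c i ℤ.* a i j)) ℤ.* h j)
      ≡⟨ sum-cong-≗ (λ j → trans (*-distribʳ-sum (h j) (λ i → c i ℤ.* a i j))
           (sum-cong-≗ (λ i → ℤ.*-assoc (c i) (a i j) (h j)))) ⟩
    ∑[ j < n ] ∑[ i < m ] (c i ℤ.* (a i j ℤ.* h j))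
      ≡⟨ ∑-comm (λ j i → c i ℤ.* (a i j ℤ.* h j)) ⟩
    ∑[ i < m ] ∑[ j < n ] (c i ℤ.* (a i j ℤ.* h j))
      ≡⟨ sum-cong-≗ (λ i → *-distribˡ-sum (c i) (λ j → a i j ℤ.* h j)) ⟨
    ∑[ i < m ] (c i ℤ.* (∑[ j < n ] (a i j ℤ.* h j))) ∎
    where open ≡-Reasoning

open ℤ-lemmas

Z₁ : {G : Graph} → Subgraph G → Submodule (C₁ G) 0ℓ
Z₁ {G} S = record
  { Member    = IsCycle S
  ; resp      = λ x≗y p → record
    { boundary = λ v → trans
        (sum-cong-≗ (λ e → cong (ℤ._* (δ (tgt G e) v ℤ.- δ (src G e) v)) (sym (x≗y e))))
        (boundary p v)
    ; support  = λ e ¬e → trans (sym (x≗y e)) (support p e ¬e)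
    }
  ; 0ᴹ-closed = record { boundary = λ v → sum-zero {E G} (λ _ → 0ℤ) (λ _ → refl) ; support = λ _ _ → refl }
  ; +ᴹ-closed = λ {x} {y} p q → record
    { boundary = λ v → trans
        (sum-cong-≗ (λ e → ℤ.*-distribʳ-+ (inc e v) (x e) (y e)))
        (trans (∑-distrib-+ (λ e → x e ℤ.* inc e v) (λ e → y e ℤ.* inc e v))
               (cong₂ ℤ._+_ (boundary p v) (boundary q v)))
    ; support  = λ e ¬e → cong₂ ℤ._+_ (support p e ¬e) (support q e ¬e)
    }
  ; -ᴹ-closed = λ {x} p → record
    { boundary = λ v → trans
        (sum-cong-≗ (λ e → sym (ℤ.neg-distribˡ-* (x e) (inc e v))))
        (trans (neg-sum (λ e → x e ℤ.* inc e v)) (cong ℤ.-_ (boundary p v)))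
    ; support  = λ e ¬e → cong ℤ.-_ (support p e ¬e)
    }
  ; *ₗ-closed = λ a {x} p → record
    { boundary = λ v → trans
        (sum-cong-≗ (λ e → ℤ.*-assoc a (x e) (inc e v)))
        (trans (sym (*-distribˡ-sum a (λ e → x e ℤ.* inc e v)))
               (trans (cong (ℤ._*_ a) (boundary p v)) (ℤ.*-zeroʳ a)))
    ; support  = λ e ¬e → trans (cong (ℤ._*_ a) (support p e ¬e)) (ℤ.*-zeroʳ a)
    }
  }
  where
  inc : Fin (E G) → Fin (V G) → ℤ
  inc e v = δ (tgt G e) v ℤ.- δ (src G e) v

B₁ : (G : Graph) → Submodule (C₁ G) 0ℓ
B₁ G = record
  { Member    = λ c → ∀ e → c e ≡ 0ℤ
  ; resp      = λ x≗y z e → trans (sym (x≗y e)) (z e)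
  ; 0ᴹ-closed = λ _ → refl
  ; +ᴹ-closed = λ z z′ e → cong₂ ℤ._+_ (z e) (z′ e)
  ; -ᴹ-closed = λ z e → cong ℤ.-_ (z e)
  ; *ₗ-closed = λ a z e → trans (cong (ℤ._*_ a) (z e)) (ℤ.*-zeroʳ a)
  }

-- Integral cellular homology; there are no 2-cells, so the boundaries are zero.
H₁ : {G : Graph} → Subgraph G → LeftModule ℤ-ring 0ℓ 0ℓ
H₁ {G} S = Z₁ S / B₁ G

record HasGenus {G : Graph} (S : Subgraph G) (g : ℕ) : Set where
  open Subgraph S
  field
    nonEmpty  : ∃ vertex
    connected : ∀ {u v} → vertex u → vertex v → EqClosure (Adjacent S) u v
    rank      : HasRank (H₁ S) g

-- For a (one-dimensional) graph: non-empty, connected, with vanishing H₁.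
Contractible : {G : Graph} → Subgraph G → Set
Contractible S = HasGenus S 0

record GenusGraph (g : ℕ) : Set where
  field
    graph : Graph
    genus : HasGenus (whole graph) g

open GenusGraph

-- A vertex, or an edge with an orientation relative to src → tgt.
Cell : Graph → Set
Cell G = Fin (V G) ⊎ (Fin (E G) × Sign)

initial final : (G : Graph) → Cell G → Fin (V G)
initial G (inj₁ v)            = v
initial G (inj₂ (e , Sign.+)) = src G e
initial G (inj₂ (e , Sign.-)) = tgt G e
final G (inj₁ v)            = v
final G (inj₂ (e , Sign.+)) = tgt G e
final G (inj₂ (e , Sign.-)) = src G e

infixr 7 _·_

_·_ : {A B : Set} → Sign → A ⊎ (B × Sign) → A ⊎ (B × Sign)
s · inj₁ v       = inj₁ v
s · inj₂ (e , t) = inj₂ (e , s *ˢ t)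

-- A very cellular map, up to homotopy through such maps, is determined by the
-- images of the vertices and, for each edge, by the vertex or the oriented edge
-- onto which it is mapped.  In particular, reversing a loop is not the identity.
record CellMap (G H : Graph) : Set where
  field
    vtx     : Fin (V G) → Fin (V H)
    edge    : Fin (E G) → Cell H
    vtx-src : ∀ e → vtx (src G e) ≡ initial H (edge e)
    vtx-tgt : ∀ e → vtx (tgt G e) ≡ final H (edge e)

  cell : Cell G → Cell H
  cell (inj₁ v)       = inj₁ (vtx v)
  cell (inj₂ (e , s)) = s · edge e

  fibre : Fin (V H) → Subgraph G
  fibre w = record
    { vertex = λ v → vtx v ≡ w
    ; edge   = λ e → edge e ≡ inj₁ w
    ; closed = λ {e} eq → trans (vtx-src e) (cong (initial H) eq) , trans (vtx-tgt e) (cong (final H) eq)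
    }

  -- The edge e is mapped onto the edge f.
  _Over_ : Fin (E G) → Fin (E H) → Set
  e Over f = ∃[ s ] edge e ≡ inj₂ (f , s)

open CellMap

-- The fibre over an interior point of an edge f is discrete, with one point for
-- each edge mapped onto f.
record IsContraction {G H : Graph} (φ : CellMap G H) : Set where
  field
    vertex-fibre : ∀ w → Contractible (fibre φ w)
    edge-fibre   : ∀ f → ∃! _≡_ (λ e → _Over_ φ e f)

open IsContraction

Contraction : Graph → Graph → Set
Contraction G H = Σ[ φ ∈ CellMap G H ] IsContraction φ

infix 4 _≗ᶜ_

_≗ᶜ_ : {G H : Graph} → Contraction G H → Contraction G H → Set
(φ , _) ≗ᶜ (ψ , _) = (∀ v → vtx φ v ≡ vtx ψ v) × (∀ e → edge φ e ≡ edge ψ e)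

module Acyclic where

  acyclic : ∀ {G} {S : Subgraph G} → HasRank (H₁ S) 0 → ∀ {c} → IsCycle S c → ∀ e → c e ≡ 0ℤ
  acyclic (b , basis) {c} z e with IsBasis.spanning basis (c , z)
  ... | _ , eq = trans (sym (ℤ.+-identityʳ (c e))) (eq e)

  rank-zero : ∀ {G} {S : Subgraph G} → (∀ {c} → IsCycle S c → ∀ e → c e ≡ 0ℤ) → HasRank (H₁ S) 0
  rank-zero h = (λ ()) , record
    { independent = λ _ _ ()
    ; spanning    = λ (c , z) → (λ ()) , λ e → trans (ℤ.+-identityʳ (c e)) (h z e)
    }

open Acyclic

idᶜ : {G : Graph} → Contraction G G
idᶜ = record
  { vtx = id ; edge = λ e → inj₂ (e , Sign.+) ; vtx-src = λ _ → refl ; vtx-tgt = λ _ → refl }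
  , record
  { vertex-fibre = λ w → record
    { nonEmpty  = w , refl
    ; connected = λ { refl refl → ε }
    ; rank      = rank-zero (λ z e → support z e (λ ()))
    }
  ; edge-fibre = λ f → f , (Sign.+ , refl) , λ { (_ , refl) → refl }
  }

module Composition {G H K : Graph} (ψ : CellMap H K) (φ : CellMap G H) where

  vtx-initial : ∀ κ → vtx ψ (initial H κ) ≡ initial K (cell ψ κ)
  vtx-initial (inj₁ w)            = refl
  vtx-initial (inj₂ (f , Sign.+)) with edge ψ f | vtx-src ψ f
  ... | inj₁ _            | eq = eq
  ... | inj₂ (_ , Sign.+) | eq = eq
  ... | inj₂ (_ , Sign.-) | eq = eq
  vtx-initial (inj₂ (f , Sign.-)) with edge ψ f | vtx-tgt ψ f
  ... | inj₁ _            | eq = eq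
  ... | inj₂ (_ , Sign.+) | eq = eq
  ... | inj₂ (_ , Sign.-) | eq = eq

  vtx-final : ∀ κ → vtx ψ (final H κ) ≡ final K (cell ψ κ)
  vtx-final (inj₁ w)            = refl
  vtx-final (inj₂ (f , Sign.+)) with edge ψ f | vtx-tgt ψ f
  ... | inj₁ _            | eq = eq
  ... | inj₂ (_ , Sign.+) | eq = eq
  ... | inj₂ (_ , Sign.-) | eq = eq
  vtx-final (inj₂ (f , Sign.-)) with edge ψ f | vtx-src ψ f
  ... | inj₁ _            | eq = eq
  ... | inj₂ (_ , Sign.+) | eq = eq
  ... | inj₂ (_ , Sign.-) | eq = eq

  composite : CellMap G K
  composite = record
    { vtx     = vtx ψ ∘ vtx φ
    ; edge    = cell ψ ∘ edge φ
    ; vtx-src = λ e → trans (cong (vtx ψ) (vtx-src φ e)) (vtx-initial (edge φ e))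
    ; vtx-tgt = λ e → trans (cong (vtx ψ) (vtx-tgt φ e)) (vtx-final (edge φ e))
    }

  ·-inj₁ : ∀ s (κ : Cell K) {x} → s · κ ≡ inj₁ x → κ ≡ inj₁ x
  ·-inj₁ s (inj₁ _) eq = eq

  ·-inj₂ : ∀ s (κ : Cell K) {k t} → s · κ ≡ inj₂ (k , t) → ∃[ u ] κ ≡ inj₂ (k , u)
  ·-inj₂ s (inj₂ (_ , u)) refl = u , refl

  cell-inj₂ : ∀ κ {k s} → cell ψ κ ≡ inj₂ (k , s) →
              ∃[ f ] ∃[ t ] κ ≡ inj₂ (f , t) × _Over_ ψ f k
  cell-inj₂ (inj₂ (f , t)) eq = f , t , refl , ·-inj₂ t (edge ψ f) eq

  module _ (ψ-contr : IsContraction ψ) (φ-contr : IsContraction φ) where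

    edge-fibre′ : ∀ k → ∃! _≡_ (λ e → _Over_ composite e k)
    edge-fibre′ k with edge-fibre ψ-contr k
    ... | f , (s , f↦k) , f-unique with edge-fibre φ-contr f
    ...   | e , (t , e↦f) , e-unique = e , (t *ˢ s , e↦k) , unique
      where
      e↦k : cell ψ (edge φ e) ≡ inj₂ (k , t *ˢ s)
      e↦k = trans (cong (cell ψ) e↦f) (cong (t ·_) f↦k)

      unique : ∀ {e′} → _Over_ composite e′ k → e ≡ e′
      unique {e′} (_ , e′↦k) with cell-inj₂ (edge φ e′) e′↦k
      ... | f′ , t′ , e′↦f′ , f′↦k =
        e-unique (t′ , trans e′↦f′ (cong (λ f → inj₂ (f , t′)) (sym (f-unique f′↦k))))

    module _ (x : Fin (V K)) where

      nonEmpty′ : ∃[ v ] vtx ψ (vtx φ v) ≡ x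
      nonEmpty′ with HasGenus.nonEmpty (vertex-fibre ψ-contr x)
      ... | w , refl with HasGenus.nonEmpty (vertex-fibre φ-contr w)
      ...   | v , refl = v , refl

      Joined : Fin (V G) → Fin (V G) → Set
      Joined = EqClosure (Adjacent (fibre composite x))

      within : ∀ {w u v} → vtx ψ w ≡ x → vtx φ u ≡ w → vtx φ v ≡ w → Joined u v
      within {w} w↦x u↦w v↦w = gmap id
        (λ (e , e↦w , ends) → e , trans (cong (cell ψ) e↦w) (cong inj₁ w↦x) , ends)
        (HasGenus.connected (vertex-fibre φ-contr w) u↦w v↦w)

      -- An edge of the fibre of ψ lifts to an edge whose ends lie over its ends.
      lift-edge : ∀ {w w′} → Adjacent (fibre ψ x) w w′ →
        ∃[ u ] ∃[ u′ ] ((vtx φ u ≡ w × vtx φ u′ ≡ w′) × vtx ψ w ≡ x × vtx ψ w′ ≡ x × Joined u u′)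
      lift-edge (f , f↦x , refl , refl) with edge-fibre φ-contr f
      ... | e , (Sign.+ , e↦f) , _ =
        src G e , tgt G e
        , (trans (vtx-src φ e) (cong (initial H) e↦f) , trans (vtx-tgt φ e) (cong (final H) e↦f))
        , proj₁ (Subgraph.closed (fibre ψ x) f↦x) , proj₂ (Subgraph.closed (fibre ψ x) f↦x)
        , fwd (e , trans (cong (cell ψ) e↦f) (cong (Sign.+ ·_) f↦x) , refl , refl) ◅ ε
      ... | e , (Sign.- , e↦f) , _ =
        tgt G e , src G e
        , (trans (vtx-tgt φ e) (cong (final H) e↦f) , trans (vtx-src φ e) (cong (initial H) e↦f))
        , proj₁ (Subgraph.closed (fibre ψ x) f↦x) , proj₂ (Subgraph.closed (fibre ψ x) f↦x)
        , bwd (e , trans (cong (cell ψ) e↦f) (cong (Sign.- ·_) f↦x) , refl , refl) ◅ ε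

      lift-path : ∀ {w w′} → EqClosure (Adjacent (fibre ψ x)) w w′ →
        ∀ {u v} → vtx ψ w ≡ x → vtx φ u ≡ w → vtx φ v ≡ w′ → Joined u v
      lift-path ε w↦x u↦w v↦w = within w↦x u↦w v↦w
      lift-path (fwd a ◅ p) w↦x u↦w v↦w′ with lift-edge a
      ... | u₁ , u₂ , (u₁↦ , u₂↦) , w₁↦x , w₂↦x , q =
        within w₁↦x u↦w u₁↦ ◅◅ q ◅◅ lift-path p w₂↦x u₂↦ v↦w′
      lift-path (bwd a ◅ p) w↦x u↦w v↦w′ with lift-edge a
      ... | u₁ , u₂ , (u₁↦ , u₂↦) , w₁↦x , w₂↦x , q =
        within w₂↦x u↦w u₂↦ ◅◅ symmetric _ q ◅◅ lift-path p w₁↦x u₁↦ v↦w′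

      connected′ : ∀ {u v} → vtx ψ (vtx φ u) ≡ x → vtx ψ (vtx φ v) ≡ x → Joined u v
      connected′ u↦x v↦x =
        lift-path (HasGenus.connected (vertex-fibre ψ-contr x) u↦x v↦x) u↦x refl refl

      module _ {c : Fin (E G) → ℤ} (z : IsCycle (fibre composite x) c) where

        pairing : (h : Fin (V G) → ℤ) → ∑[ e < E G ] (c e ℤ.* (h (tgt G e) ℤ.- h (src G e))) ≡ 0ℤ
        pairing h = begin
          ∑[ e < E G ] (c e ℤ.* (h (tgt G e) ℤ.- h (src G e)))
            ≡⟨ sum-cong-≗ (λ e → cong (ℤ._*_ (c e)) (sym (δ-diff (tgt G e) (src G e) h))) ⟩
          ∑[ e < E G ] (c e ℤ.* (∑[ v < V G ] ((δ (tgt G e) v ℤ.- δ (src G e) v) ℤ.* h v)))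
            ≡⟨ swap-sum c (λ e v → δ (tgt G e) v ℤ.- δ (src G e) v) h ⟨
          ∑[ v < V G ] (∂ G c v ℤ.* h v)
            ≡⟨ sum-zero _ (λ v → cong (ℤ._* h v) (boundary z v)) ⟩
          0ℤ ∎
          where open ≡-Reasoning

        coeff : Cell H → Fin (E H) → ℤ
        coeff (inj₁ _)       f  = 0ℤ
        coeff (inj₂ (f , s)) f′ = (s ℤ.◃ 1) ℤ.* δ f f′

        push : Fin (E H) → ℤ
        push f = ∑[ e < E G ] (c e ℤ.* coeff (edge φ e) f)

        coeff-diff : ∀ κ (h : Fin (V H) → ℤ) →
          ∑[ f < E H ] (coeff κ f ℤ.* (h (tgt H f) ℤ.- h (src H f))) ≡ h (final H κ) ℤ.- h (initial H κ)
        coeff-diff (inj₁ w) h =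
          trans (sum-zero {E H} (λ _ → 0ℤ) (λ _ → refl)) (sym (ℤ.+-inverseʳ (h w)))
        coeff-diff (inj₂ (f , s)) h = begin
          ∑[ f′ < E H ] (((s ℤ.◃ 1) ℤ.* δ f f′) ℤ.* d f′)
            ≡⟨ sum-cong-≗ (λ f′ → ℤ.*-assoc (s ℤ.◃ 1) (δ f f′) (d f′)) ⟩
          ∑[ f′ < E H ] ((s ℤ.◃ 1) ℤ.* (δ f f′ ℤ.* d f′))
            ≡⟨ *-distribˡ-sum (s ℤ.◃ 1) (λ f′ → δ f f′ ℤ.* d f′) ⟨
          (s ℤ.◃ 1) ℤ.* (∑[ f′ < E H ] (δ f f′ ℤ.* d f′))
            ≡⟨ cong (ℤ._*_ (s ℤ.◃ 1)) (δ-sum f d) ⟩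
          (s ℤ.◃ 1) ℤ.* d f
            ≡⟨ signed s ⟩
          h (final H (inj₂ (f , s))) ℤ.- h (initial H (inj₂ (f , s))) ∎
          where
          open ≡-Reasoning
          d : Fin (E H) → ℤ
          d f′ = h (tgt H f′) ℤ.- h (src H f′)
          signed : ∀ s → (s ℤ.◃ 1) ℤ.* d f ≡ h (final H (inj₂ (f , s))) ℤ.- h (initial H (inj₂ (f , s)))
          signed Sign.+ = ℤ.*-identityˡ (d f)
          signed Sign.- = trans (ℤ.-1*i≡-i (d f)) (neg-minus (h (tgt H f)) (h (src H f)))

        push-cycle : IsCycle (fibre ψ x) push
        push-cycle = record { boundary = push-boundary ; support = push-support }
          where
          push-boundary : ∀ w → ∂ H push w ≡ 0ℤ
          push-boundary w = begin
            ∂ H push w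
              ≡⟨ swap-sum c (λ e → coeff (edge φ e)) (λ f → h (tgt H f) ℤ.- h (src H f)) ⟩
            ∑[ e < E G ] (c e ℤ.* (∑[ f < E H ] (coeff (edge φ e) f ℤ.* (h (tgt H f) ℤ.- h (src H f)))))
              ≡⟨ sum-cong-≗ (λ e → cong (ℤ._*_ (c e)) (coeff-diff (edge φ e) h)) ⟩
            ∑[ e < E G ] (c e ℤ.* (h (final H (edge φ e)) ℤ.- h (initial H (edge φ e))))
              ≡⟨ sum-cong-≗ (λ e → cong (ℤ._*_ (c e))
                   (cong₂ (λ a b → h a ℤ.- h b) (sym (vtx-tgt φ e)) (sym (vtx-src φ e)))) ⟩
            ∑[ e < E G ] (c e ℤ.* (h (vtx φ (tgt G e)) ℤ.- h (vtx φ (src G e))))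
              ≡⟨ pairing (h ∘ vtx φ) ⟩
            0ℤ ∎
            where
            open ≡-Reasoning
            h : Fin (V H) → ℤ
            h u = δ u w

          push-support : ∀ f → ¬ edge ψ f ≡ inj₁ x → push f ≡ 0ℤ
          push-support f f↛x = sum-zero _ term
            where
            term : ∀ e → c e ℤ.* coeff (edge φ e) f ≡ 0ℤ
            term e with edge φ e in e↦
            ... | inj₁ _        = ℤ.*-zeroʳ (c e)
            ... | inj₂ (f′ , s) with f′ ≟ f
            ...   | no f′≢f  = trans (cong (ℤ._*_ (c e)) (ℤ.*-zeroʳ (s ℤ.◃ 1))) (ℤ.*-zeroʳ (c e))
            ...   | yes refl = cong (ℤ._* ((s ℤ.◃ 1) ℤ.* 1ℤ)) (support z e λ eq →
              f↛x (·-inj₁ s (edge ψ f) (trans (sym (cong (cell ψ) e↦)) eq)))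

        -- A cycle of the composite's fibre lives on the edges contracted by φ.
        vanish : ∀ {e f s} → edge φ e ≡ inj₂ (f , s) → c e ≡ 0ℤ
        vanish {e} {f} {s} e↦f = cancel s (begin
          c e ℤ.* ((s ℤ.◃ 1) ℤ.* 1ℤ)      ≡⟨ cong (λ a → c e ℤ.* ((s ℤ.◃ 1) ℤ.* a)) (sym (δ-refl f)) ⟩
          c e ℤ.* coeff (inj₂ (f , s)) f  ≡⟨ cong (λ κ → c e ℤ.* coeff κ f) (sym e↦f) ⟩
          c e ℤ.* coeff (edge φ e) f      ≡⟨ sum-single _ e others ⟨
          push f                          ≡⟨ acyclic (HasGenus.rank (vertex-fibre ψ-contr x)) push-cycle f ⟩
          0ℤ                              ∎)
          where
          open ≡-Reasoning
          cancel : ∀ s {a} → a ℤ.* ((s ℤ.◃ 1) ℤ.* 1ℤ) ≡ 0ℤ → a ≡ 0ℤ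
          cancel s {a} eq with ℤ.i*j≡0⇒i≡0∨j≡0 a eq
          cancel s      eq | inj₁ p = p
          cancel Sign.+ eq | inj₂ ()
          cancel Sign.- eq | inj₂ ()

          others : ∀ e′ → e′ ≢ e → c e′ ℤ.* coeff (edge φ e′) f ≡ 0ℤ
          others e′ e′≢e with edge φ e′ in e′↦
          ... | inj₁ _        = ℤ.*-zeroʳ (c e′)
          ... | inj₂ (f′ , t) with f′ ≟ f
          ...   | no f′≢f  = trans (cong (ℤ._*_ (c e′)) (ℤ.*-zeroʳ (t ℤ.◃ 1))) (ℤ.*-zeroʳ (c e′))
          ...   | yes refl with edge-fibre φ-contr f
          ...     | _ , _ , unique = ⊥-elim (e′≢e (trans (sym (unique (t , e′↦))) (unique (s , e↦f))))

        part : Fin (V H) → Fin (E G) → ℤ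
        part w e = c e ℤ.* δ (vtx φ (src G e)) w

        part-cycle : ∀ w → IsCycle (fibre φ w) (part w)
        part-cycle w = record { boundary = part-boundary ; support = part-support }
          where
          inc : Fin (E G) → Fin (V G) → ℤ
          inc e v = δ (tgt G e) v ℤ.- δ (src G e) v

          δ-subst : ∀ u v → δ (vtx φ u) w ℤ.* δ u v ≡ δ u v ℤ.* δ (vtx φ v) w
          δ-subst u v with u ≟ v
          ... | yes refl = ℤ.*-comm (δ (vtx φ u) w) 1ℤ
          ... | no _     = ℤ.*-zeroʳ (δ (vtx φ u) w)

          term : ∀ v e → part w e ℤ.* inc e v ≡ (c e ℤ.* inc e v) ℤ.* δ (vtx φ v) w
          term v e with edge φ e in e↦
          ... | inj₂ _ rewrite vanish e↦ = refl
          ... | inj₁ y = begin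
            (c e ℤ.* b) ℤ.* inc e v      ≡⟨ ℤ.*-assoc (c e) b (inc e v) ⟩
            c e ℤ.* (b ℤ.* inc e v)      ≡⟨ cong (ℤ._*_ (c e)) middle ⟩
            c e ℤ.* (inc e v ℤ.* d)      ≡⟨ ℤ.*-assoc (c e) (inc e v) d ⟨
            (c e ℤ.* inc e v) ℤ.* d      ∎
            where
            open ≡-Reasoning
            b d : ℤ
            b = δ (vtx φ (src G e)) w
            d = δ (vtx φ v) w
            same : vtx φ (src G e) ≡ vtx φ (tgt G e)
            same = trans (vtx-src φ e) (trans (cong (initial H) e↦)
                     (sym (trans (vtx-tgt φ e) (cong (final H) e↦))))
            middle : b ℤ.* inc e v ≡ inc e v ℤ.* d
            middle = begin
              b ℤ.* inc e v
                ≡⟨ *-distribˡ-minus b (δ (tgt G e) v) (δ (src G e) v) ⟩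
              b ℤ.* δ (tgt G e) v ℤ.- b ℤ.* δ (src G e) v
                ≡⟨ cong₂ ℤ._-_
                     (trans (cong (λ a → δ a w ℤ.* δ (tgt G e) v) same) (δ-subst (tgt G e) v))
                     (δ-subst (src G e) v) ⟩
              δ (tgt G e) v ℤ.* d ℤ.- δ (src G e) v ℤ.* d
                ≡⟨ *-distribʳ-minus (δ (tgt G e) v) (δ (src G e) v) d ⟨
              inc e v ℤ.* d ∎

          part-boundary : ∀ v → ∂ G (part w) v ≡ 0ℤ
          part-boundary v = trans (sum-cong-≗ (term v))
            (trans (sym (*-distribʳ-sum (δ (vtx φ v) w) (λ e → c e ℤ.* inc e v)))
                   (cong (ℤ._* δ (vtx φ v) w) (boundary z v)))

          part-support : ∀ e → ¬ edge φ e ≡ inj₁ w → part w e ≡ 0ℤ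
          part-support e e↛w with edge φ e in e↦
          ... | inj₂ _ = cong (ℤ._* δ (vtx φ (src G e)) w) (vanish e↦)
          ... | inj₁ y = trans
            (cong (ℤ._*_ (c e)) (δ-≢ λ eq → e↛w (cong inj₁
              (trans (sym (trans (vtx-src φ e) (cong (initial H) e↦))) eq))))
            (ℤ.*-zeroʳ (c e))

        acyclic′ : ∀ e → c e ≡ 0ℤ
        acyclic′ e = begin
          c e            ≡⟨ ℤ.*-identityʳ (c e) ⟨
          c e ℤ.* 1ℤ     ≡⟨ cong (ℤ._*_ (c e)) (δ-refl (vtx φ (src G e))) ⟨
          part w e       ≡⟨ acyclic (HasGenus.rank (vertex-fibre φ-contr w)) (part-cycle w) e ⟩
          0ℤ             ∎
          where
          open ≡-Reasoning
          w : Fin (V H)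
          w = vtx φ (src G e)

    isContraction : IsContraction composite
    isContraction = record
      { vertex-fibre = λ x → record
        { nonEmpty = nonEmpty′ x ; connected = connected′ x ; rank = rank-zero (acyclic′ x) }
      ; edge-fibre   = edge-fibre′
      }

infixr 9 _∘ᶜ_

_∘ᶜ_ : {G H K : Graph} → Contraction H K → Contraction G H → Contraction G K
(ψ , ψ-contr) ∘ᶜ (φ , φ-contr) =
  Composition.composite ψ φ , Composition.isContraction ψ φ ψ-contr φ-contr

module _ {r ℓr : Level} (R : Ring r ℓr) (g : ℕ) where

  record Rep (ℓ : Level) : Set (r ⊔ ℓr ⊔ lsuc ℓ) where
    field
      obj : GenusGraph g → LeftModule R ℓ ℓ

    ⟦_⟧ : GenusGraph g → Set ℓ
    ⟦ G ⟧ = LeftModule.Carrierᴹ (obj G)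

    infix 4 _≈_
    _≈_ : {G : GenusGraph g} → ⟦ G ⟧ → ⟦ G ⟧ → Set ℓ
    _≈_ {G} = LeftModule._≈ᴹ_ (obj G)

    field
      map : ∀ {G H} → Contraction (graph G) (graph H) → ⟦ H ⟧ → ⟦ G ⟧
      map-isHomomorphism : ∀ {G H} (φ : Contraction (graph G) (graph H)) →
        LeftModuleMorphisms.IsLeftModuleHomomorphism
          (LeftModule.rawLeftModule (obj H)) (LeftModule.rawLeftModule (obj G)) (map {G} {H} φ)
      map-resp : ∀ {G H} {φ ψ : Contraction (graph G) (graph H)} → φ ≗ᶜ ψ →
        ∀ x → _≈_ {G} (map {G} {H} φ x) (map {G} {H} ψ x)
      map-id : ∀ {G} x → _≈_ {G} (map {G} {G} idᶜ x) x
      map-∘ : ∀ {G H K} (ψ : Contraction (graph H) (graph K)) (φ : Contraction (graph G) (graph H)) x →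
        _≈_ {G} (map {G} {K} (ψ ∘ᶜ φ) x) (map {G} {H} φ (map {H} {K} ψ x))

module _ {r ℓr : Level} {R : Ring r ℓr} {g : ℕ} {ℓ : Level} where

  record Subrep (M : Rep R g ℓ) : Set (r ⊔ lsuc ℓ) where
    open Rep M
    field
      sub        : ∀ G → Submodule (obj G) ℓ
      map-closed : ∀ {G H} (φ : Contraction (graph G) (graph H)) {x} →
        Member (sub H) x → Member (sub G) (map {G} {H} φ x)

  open Subrep

  infix 4 _⊆ᴿ_ _≅_
  infixl 7 _/ᴿ_

  _⊆ᴿ_ : {M : Rep R g ℓ} → Subrep M → Subrep M → Set ℓ
  Q ⊆ᴿ P = ∀ G → sub Q G ⊆ sub P G

  -- Used only when Q ⊆ᴿ P.
  _/ᴿ_ : {M : Rep R g ℓ} → Subrep M → Subrep M → Rep R g ℓ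
  _/ᴿ_ {M} P Q = record
    { obj = λ G → sub P G / sub Q G
    ; map = λ {G} {H} φ (x , p) → map {G} {H} φ x , map-closed P {G} {H} φ p
    ; map-isHomomorphism = λ {G} {H} φ → record
      { +ᴹ-isGroupHomomorphism = record
        { isMonoidHomomorphism = record
          { isMagmaHomomorphism = record
            { isRelHomomorphism = record
              { cong = λ q → Submodule.resp (sub Q G)
                  (≈ᴹ-trans (obj G) (+ᴹ-homo (hom G H φ) _ _) (+ᴹ-congˡ (obj G) (-ᴹ-homo (hom G H φ) _)))
                  (map-closed Q {G} {H} φ q)
              }
            ; homo = λ _ _ → ≈ᴹ⇒difference (sub Q G) (+ᴹ-homo (hom G H φ) _ _)
            }
          ; ε-homo = ≈ᴹ⇒difference (sub Q G) (0ᴹ-homo (hom G H φ))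
          }
        ; ⁻¹-homo = λ _ → ≈ᴹ⇒difference (sub Q G) (-ᴹ-homo (hom G H φ) _)
        }
      ; *ₗ-homo = λ _ _ → ≈ᴹ⇒difference (sub Q G) (*ₗ-homo (hom G H φ) _ _)
      }
    ; map-resp = λ {G} {H} {φ} {ψ} φ≗ψ (x , _) →
        ≈ᴹ⇒difference (sub Q G) (map-resp {G} {H} {φ} {ψ} φ≗ψ x)
    ; map-id = λ {G} (x , _) → ≈ᴹ⇒difference (sub Q G) (map-id {G} x)
    ; map-∘ = λ {G} {H} {K} ψ φ (x , _) → ≈ᴹ⇒difference (sub Q G) (map-∘ {G} {H} {K} ψ φ x)
    }
    where
    open Rep M
    open LeftModule using (≈ᴹ-trans; +ᴹ-congˡ)
    open LeftModuleMorphisms.IsLeftModuleHomomorphism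
    hom = λ G H → map-isHomomorphism {G} {H}

  ⨁ᴿ : {n : ℕ} → (Fin n → Rep R g ℓ) → Rep R g ℓ
  ⨁ᴿ M = record
    { obj = λ G → ⨁ (λ i → obj (M i) G)
    ; map = λ {G} {H} φ x i → map (M i) {G} {H} φ (x i)
    ; map-isHomomorphism = λ {G} {H} φ → record
      { +ᴹ-isGroupHomomorphism = record
        { isMonoidHomomorphism = record
          { isMagmaHomomorphism = record
            { isRelHomomorphism = record { cong = λ eq i → ⟦⟧-cong (hom i G H φ) (eq i) }
            ; homo = λ x y i → +ᴹ-homo (hom i G H φ) (x i) (y i)
            }
          ; ε-homo = λ i → 0ᴹ-homo (hom i G H φ)
          }
        ; ⁻¹-homo = λ x i → -ᴹ-homo (hom i G H φ) (x i)
        }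
      ; *ₗ-homo = λ a x i → *ₗ-homo (hom i G H φ) a (x i)
      }
    ; map-resp = λ {G} {H} {φ} {ψ} φ≗ψ x i → map-resp (M i) {G} {H} {φ} {ψ} φ≗ψ (x i)
    ; map-id = λ {G} x i → map-id (M i) {G} (x i)
    ; map-∘ = λ {G} {H} {K} ψ φ x i → map-∘ (M i) {G} {H} {K} ψ φ (x i)
    }
    where
    open Rep
    open LeftModuleMorphisms.IsLeftModuleHomomorphism
    hom = λ i G H → map-isHomomorphism (M i) {G} {H}

  record _≅_ (M N : Rep R g ℓ) : Set (r ⊔ ℓ) where
    private
      module M = Rep M
      module N = Rep N
    field
      to              : ∀ G → M.⟦ G ⟧ → N.⟦ G ⟧
      isIsomorphism   : ∀ G → LeftModuleMorphisms.IsLeftModuleIsomorphism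
        (LeftModule.rawLeftModule (M.obj G)) (LeftModule.rawLeftModule (N.obj G)) (to G)
      natural         : ∀ {G H} (φ : Contraction (graph G) (graph H)) x →
        N._≈_ {G} (to G (M.map {G} {H} φ x)) (N.map {G} {H} φ (to H x))

  record GeneratedInDegree≤ (d : ℕ) (M : Rep R g ℓ) : Set (r ⊔ ℓ) where
    open Rep M
    field
      size   : ℕ
      G      : Fin size → GenusGraph g
      degree : ∀ i → ∣ graph (G i) ∣ ℕ.≤ d
      v      : ∀ i → ⟦ G i ⟧
      spans  : ∀ H (x : ⟦ H ⟧) →
        _∈Span_ (obj H) {I = Σ[ i ∈ Fin size ] Contraction (graph H) (graph (G i))}
          x (λ (i , φ) → map {H} {G i} φ (v i))

  record Small (d : ℕ) (M : Rep R g ℓ) : Set (r ⊔ ℓr ⊔ lsuc ℓ) where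
    field
      N         : Rep R g ℓ
      generated : GeneratedInDegree≤ d N
      P Q       : Subrep N
      Q⊆P       : Q ⊆ᴿ P
      M≅P/Q     : M ≅ P /ᴿ Q

  record Filtration (M : Rep R g ℓ) : Set (r ⊔ lsuc ℓ) where
    open Rep M
    field
      length : ℕ
      F      : Fin (suc length) → Subrep M
      bottom : ∀ G {x} → Member (sub (F zero) G) x → _≈_ {G} x (LeftModule.0ᴹ (obj G))
      top    : ∀ G x → Member (sub (F (fromℕ length)) G) x
      mono   : ∀ i → F (inject₁ i) ⊆ᴿ F (suc i)

    graded : Rep R g ℓ
    graded = ⨁ᴿ {length} (λ i → F (suc i) /ᴿ F (inject₁ i))

  Smallish : (d : ℕ) → Rep R g ℓ → Set (r ⊔ ℓr ⊔ lsuc ℓ)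
  Smallish d M = Σ[ F ∈ Filtration M ] Small d (Filtration.graded F)

field-ring : {c ℓ₁ ℓ₂ : Level} → HeytingField c ℓ₁ ℓ₂ → Ring c ℓ₁
field-ring k = CommutativeRing.ring
  (HeytingCommutativeRing.commutativeRing (HeytingField.heytingCommutativeRing k))

-- Integer polynomials of degree at most d: the coefficients of 1, t, …, tᵈ in this order.
Polynomial≤ : ℕ → Set
Polynomial≤ d = Vec ℤ (suc d)

eval : {d : ℕ} → Polynomial≤ d → ℤ → ℤ
eval f t = foldr′ (λ a y → a ℤ.+ t ℤ.* y) 0ℤ f

{-# OPTIONS --safe #-}

-- A contraction H → K is determined by the edge of H over each edge of K together with
-- its orientation: these fix which edges of H are collapsed, and since K is connected,
-- every vertex of K is an end of an edge (unless K is a point), so its fibre is the component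
-- of the collapsed subgraph containing a lifted end.  Hence a module generated by n elements
-- in degrees ≤ d is spanned at H by at most n (1 + 2|H|)ᵈ elements.  Subspaces, quotients and
-- direct summands need no more generators, and a module with a filtration of length m, each
-- of whose pieces needs at most N generators, needs at most m N.
--
-- Excluded middle enters under ¬ ¬ and only finitely often; a statement about all
-- elements of a subspace comes from the negation of one existential by tightness of #.
module Submission where

open import Algebra.Apartness.Bundles using (HeytingField)
open import Algebra.Bundles using (Ring)
open import Algebra.Module.Bundles using (LeftModule)
open import Algebra.Module.Morphism.Structures using (module LeftModuleMorphisms)
import Algebra.Module.Properties.LeftModule
import Algebra.Properties.AbelianGroup
import Algebra.Properties.CommutativeMonoid.Sum
import Algebra.Properties.CommutativeSemigroup
import Algebra.Properties.Ring
open import Data.Fin.Base using (Fin; zero; suc; inject₁; inject≤; fromℕ; punchIn; punchOut; combine; remQuot; funToFin; finToFun)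
open import Data.Fin.Induction using (<-weakInduction)
import Data.Fin.Properties as Fin
open import Data.Integer.Base as ℤ using (ℤ; +_; _≤_; 0ℤ)
import Data.Integer.Properties as ℤ
open import Data.Integer.Tactic.RingSolver using (solve-∀)
open import Data.Nat.Base as ℕ using (ℕ; zero; suc)
import Data.Nat.Properties as ℕ
open import Data.Product.Base using (Σ-syntax; ∃-syntax; _×_; _,_; proj₁; proj₂; uncurry)
open import Data.Sign.Base using (Sign)
open import Data.Sum.Base using (_⊎_; inj₁; inj₂; reduce)
open import Data.Sum.Properties using (inj₂-injective)
open import Data.Vec.Base using ([]; _∷_)
open import Data.Vec.Functional using () renaming (_∷_ to _∷ᶠ_)
open import Function.Base using (_∘_)
open import Level using (Level; _⊔_)
open import Relation.Binary.Construct.Closure.Equivalence using (EqClosure)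
open import Relation.Binary.Construct.Closure.ReflexiveTransitive using (ε; _◅_)
open import Relation.Binary.Construct.Closure.Symmetric using (fwd; bwd)
open import Relation.Binary.PropositionalEquality using (_≡_; refl; sym; trans; cong; cong₂; subst; module ≡-Reasoning)
import Relation.Binary.Reasoning.Setoid
open import Relation.Nullary.Decidable using (Dec; yes; no; ¬¬-excluded-middle)
open import Relation.Nullary.Negation.Core using (¬_; contradiction; ¬¬-map)
open import Defs

open Submodule using (Member)

-- Double negation passes through finite products but not through arbitrary ones, so every use of
-- excluded middle has to be arranged over some `Fin n`.
finite-choice : ∀ {p n} {P : Fin n → Set p} → (∀ i → ¬ ¬ P i) → ¬ ¬ (∀ i → P i)
finite-choice {n = zero}  p ¬∀ = ¬∀ λ ()
finite-choice {n = suc n} p ¬∀ = p zero λ p₀ → finite-choice (p ∘ suc) λ ps →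
  ¬∀ λ { zero → p₀ ; (suc i) → ps i }

-- Linear combinations, spans and generating families.

module _ {r ℓr m ℓm : Level} {R : Ring r ℓr} (M : LeftModule R m ℓm) where

  open LeftModule M
  private module R = Ring R
  open R using (1#)
  open Algebra.Properties.CommutativeMonoid.Sum +ᴹ-commutativeMonoid
    using (sum; sum-cong-≋; sum-remove; ∑-distrib-+; sum-replicate-zero)
  open Algebra.Module.Properties.LeftModule M using (inverseʳ-uniqueᴹ)
  open Relation.Binary.Reasoning.Setoid ≈ᴹ-setoid

  private variable
    n : ℕ

  combination-+ : (c c′ : Fin n → R.Carrier) (b : Fin n → Carrierᴹ) →
    combination M (λ j → c j R.+ c′ j) b ≈ᴹ combination M c b +ᴹ combination M c′ b
  combination-+ c c′ b = ≈ᴹ-trans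
    (sum-cong-≋ (λ j → *ₗ-distribʳ (b j) (c j) (c′ j)))
    (∑-distrib-+ (λ j → c j *ₗ b j) (λ j → c′ j *ₗ b j))

  combination-* : ∀ a (c : Fin n → R.Carrier) (b : Fin n → Carrierᴹ) →
    combination M (λ j → a R.* c j) b ≈ᴹ a *ₗ combination M c b
  combination-* {zero}  a c b = ≈ᴹ-sym (*ₗ-zeroʳ a)
  combination-* {suc n} a c b = begin
    (a R.* c zero) *ₗ b zero +ᴹ combination M (λ j → a R.* c (suc j)) (b ∘ suc)
      ≈⟨ +ᴹ-cong (*ₗ-assoc a (c zero) (b zero)) (combination-* a (c ∘ suc) (b ∘ suc)) ⟩
    a *ₗ c zero *ₗ b zero +ᴹ a *ₗ combination M (c ∘ suc) (b ∘ suc)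
      ≈⟨ *ₗ-distribˡ a _ _ ⟨
    a *ₗ (c zero *ₗ b zero +ᴹ combination M (c ∘ suc) (b ∘ suc)) ∎

  combination-0 : (b : Fin n → Carrierᴹ) → combination M (λ _ → R.0#) b ≈ᴹ 0ᴹ
  combination-0 {n} b = ≈ᴹ-trans (sum-cong-≋ (λ j → *ₗ-zeroˡ (b j))) (sum-replicate-zero n)

  combination-tail : (c : Fin (suc n) → R.Carrier) (b : Fin (suc n) → Carrierᴹ) → c zero R.≈ R.0# →
    combination M c b ≈ᴹ combination M (c ∘ suc) (b ∘ suc)
  combination-tail c b c₀≈0 =
    ≈ᴹ-trans (+ᴹ-congʳ (≈ᴹ-trans (*ₗ-congʳ c₀≈0) (*ₗ-zeroˡ (b zero)))) (+ᴹ-identityˡ _)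

  combination-remove : ∀ i (c : Fin (suc n) → R.Carrier) (b : Fin (suc n) → Carrierᴹ) →
    combination M c b ≈ᴹ c i *ₗ b i +ᴹ combination M (c ∘ punchIn i) (b ∘ punchIn i)
  combination-remove i c b = sum-remove {i = i} (λ j → c j *ₗ b j)

  -1*x≈-x : ∀ x → (R.- 1#) *ₗ x ≈ᴹ -ᴹ x
  -1*x≈-x x = inverseʳ-uniqueᴹ x _ (begin
    x +ᴹ (R.- 1#) *ₗ x         ≈⟨ +ᴹ-congʳ (*ₗ-identityˡ x) ⟨
    1# *ₗ x +ᴹ (R.- 1#) *ₗ x   ≈⟨ *ₗ-distribʳ x 1# (R.- 1#) ⟨
    (1# R.+ R.- 1#) *ₗ x       ≈⟨ *ₗ-congʳ (R.-‿inverseʳ 1#) ⟩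
    R.0# *ₗ x                  ≈⟨ *ₗ-zeroˡ x ⟩
    0ᴹ                         ∎)

  x-y+y≈x : ∀ x y → (x +ᴹ -ᴹ y) +ᴹ y ≈ᴹ x
  x-y+y≈x x y = begin
    (x +ᴹ -ᴹ y) +ᴹ y   ≈⟨ +ᴹ-assoc x (-ᴹ y) y ⟩
    x +ᴹ (-ᴹ y +ᴹ y)   ≈⟨ +ᴹ-congˡ (-ᴹ‿inverseˡ y) ⟩
    x +ᴹ 0ᴹ            ≈⟨ +ᴹ-identityʳ x ⟩
    x                  ∎

  combination-closed : ∀ {p} (S : Submodule M p) (c : Fin n → R.Carrier) {b : Fin n → Carrierᴹ} →
    (∀ j → Member S (b j)) → Member S (combination M c b)
  combination-closed {zero}  S c b∈S = Submodule.0ᴹ-closed S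
  combination-closed {suc n} S c b∈S = Submodule.+ᴹ-closed S
    (Submodule.*ₗ-closed S (c zero) (b∈S zero))
    (combination-closed S (c ∘ suc) (b∈S ∘ suc))

  span : (Fin n → Carrierᴹ) → Submodule M (r ⊔ ℓm)
  span b = record
    { Member    = λ x → Σ[ c ∈ _ ] x ≈ᴹ combination M c b
    ; resp      = λ x≈y (c , eq) → c , ≈ᴹ-trans (≈ᴹ-sym x≈y) eq
    ; 0ᴹ-closed = _ , ≈ᴹ-sym (combination-0 b)
    ; +ᴹ-closed = λ (c , eq) (c′ , eq′) →
        _ , ≈ᴹ-trans (+ᴹ-cong eq eq′) (≈ᴹ-sym (combination-+ c c′ b))
    ; -ᴹ-closed = λ {x} (c , eq) →
        _ , ≈ᴹ-trans (≈ᴹ-sym (-1*x≈-x x)) (≈ᴹ-trans (*ₗ-congˡ eq) (≈ᴹ-sym (combination-* (R.- 1#) c b)))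
    ; *ₗ-closed = λ a (c , eq) → _ , ≈ᴹ-trans (*ₗ-congˡ eq) (≈ᴹ-sym (combination-* a c b))
    }

  ∈span : (b : Fin n → Carrierᴹ) → ∀ j → Member (span b) (b j)
  ∈span {suc n} b zero = (1# ∷ᶠ λ _ → R.0#) , (begin
    b zero                                              ≈⟨ +ᴹ-identityʳ _ ⟨
    b zero +ᴹ 0ᴹ                                        ≈⟨ +ᴹ-cong (*ₗ-identityˡ _) (combination-0 (b ∘ suc)) ⟨
    1# *ₗ b zero +ᴹ combination M (λ _ → R.0#) (b ∘ suc) ∎)
  ∈span {suc n} b (suc j) with c , eq ← ∈span (b ∘ suc) j =
    (R.0# ∷ᶠ c) , ≈ᴹ-trans eq (≈ᴹ-sym (combination-tail (R.0# ∷ᶠ c) b R.refl))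

  -- Zeros and repetitions are allowed, so an exact count `n` serves as an upper bound. Independence
  -- is extracted only at the very end, by `generated⇒hasRank`.
  GeneratedBy : ℕ → Set (r ⊔ m ⊔ ℓm)
  GeneratedBy n = Σ[ b ∈ (Fin n → Carrierᴹ) ] ∀ x → Member (span b) x

  -- Induction up the filtration: subtracting a combination of the `b i` moves an element one step
  -- down, and the lifts used at all `k` steps together generate. The last hypothesis is generation
  -- of the successive quotients, phrased without forming them.
  filtration-generated : ∀ {p k} (F : Fin (suc k) → Submodule M p) →
    (∀ {x} → Member (F zero) x → x ≈ᴹ 0ᴹ) → (∀ x → Member (F (fromℕ k)) x) →
    (b : Fin k → Fin n → Carrierᴹ) →
    (∀ i {x} → Member (F (suc i)) x →
      Σ[ y ∈ Carrierᴹ ] Member (span (b i)) y × Member (F (inject₁ i)) (x +ᴹ -ᴹ y)) →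
    GeneratedBy (k ℕ.* n)
  filtration-generated {n} {k = k} F bottom top b step =
    b′ , λ x → <-weakInduction (λ i → ∀ {x} → Member (F i) x → Member S x) base ind (fromℕ k) (top x)
    where
    b′ : Fin (k ℕ.* n) → Carrierᴹ
    b′ = uncurry b ∘ remQuot n
    S = span b′
    base : ∀ {x} → Member (F zero) x → Member S x
    base x∈F = Submodule.resp S (≈ᴹ-sym (bottom x∈F)) (Submodule.0ᴹ-closed S)
    b∈S : ∀ i j → Member S (b i j)
    b∈S i j = subst (λ t → Member S (uncurry b t)) (Fin.remQuot-combine i j) (∈span b′ (combine i j))
    ind : ∀ i → (∀ {x} → Member (F (inject₁ i)) x → Member S x) → ∀ {x} → Member (F (suc i)) x → Member S x
    ind i hyp {x} x∈F with y , (c , eq) , x-y∈F ← step i x∈F =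
      Submodule.resp S (x-y+y≈x x y) (Submodule.+ᴹ-closed S (hyp x-y∈F)
        (Submodule.resp S (≈ᴹ-sym eq) (combination-closed S c (b∈S i))))

  -- The index type `I` may be infinite, but `v` depends only on the code, so one representative for
  -- each attained code suffices. Deciding which of the `n` codes are attained is a finite use of
  -- excluded middle.
  encoded-generated : ∀ {i} {I : Set i} (v : I → Carrierᴹ) (code : I → Fin n) →
    (∀ a a′ → code a ≡ code a′ → v a ≈ᴹ v a′) → (∀ x → _∈Span_ M x v) → ¬ ¬ GeneratedBy n
  encoded-generated {n} {I = I} v code respects spans ¬gen =
    finite-choice (λ t → ¬¬-excluded-middle) λ dec → ¬gen (generators dec)
    where
    module _ (dec : ∀ t → Dec (∃[ a ] code a ≡ t)) where
      pick : ∀ {t} → Dec (∃[ a ] code a ≡ t) → Carrierᴹ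
      pick (yes (a , _)) = v a
      -- A code that is not attained still occupies a slot; zero fills it harmlessly.
      pick (no _)        = 0ᴹ
      b : Fin n → Carrierᴹ
      b t = pick (dec t)
      v≈b : ∀ a (d : Dec (∃[ a′ ] code a′ ≡ code a)) → v a ≈ᴹ pick d
      v≈b a (yes (a′ , eq)) = respects a a′ (sym eq)
      v≈b a (no ∄)          = contradiction (a , refl) ∄
      v∈span : ∀ a → Member (span b) (v a)
      v∈span a = Submodule.resp (span b) (≈ᴹ-sym (v≈b a (dec (code a)))) (∈span b (code a))
      generators : GeneratedBy n
      generators = b , λ x → let (_ , a , c , eq) = spans x in
        Submodule.resp (span b) (≈ᴹ-sym eq) (combination-closed (span b) c (v∈span ∘ a))

-- Generators of quotients, direct summands and isomorphic modules.

module _ {r ℓr : Level} {R : Ring r ℓr} where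

  private
    variable
      m ℓm m′ ℓm′ p : Level
      n : ℕ

  combination-/ : {M : LeftModule R m ℓm} (P Q : Submodule M p)
    (c : Fin n → Ring.Carrier R) (b : Fin n → LeftModule.Carrierᴹ (P / Q)) →
    proj₁ (combination (P / Q) c b) ≡ combination M c (proj₁ ∘ b)
  combination-/ {n = zero}  P Q c b = refl
  combination-/ {n = suc n} {M = M} P Q c b = cong (LeftModule._+ᴹ_ M _) (combination-/ P Q (c ∘ suc) (b ∘ suc))

  combination-⨁ : ∀ {k} (M : Fin k → LeftModule R m ℓm) i
    (c : Fin n → Ring.Carrier R) (b : Fin n → LeftModule.Carrierᴹ (⨁ M)) →
    combination (⨁ M) c b i ≡ combination (M i) c (λ j → b j i)
  combination-⨁ {n = zero}  M i c b = refl
  combination-⨁ {n = suc n} M i c b = cong (LeftModule._+ᴹ_ (M i) _) (combination-⨁ M i (c ∘ suc) (b ∘ suc))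

  generates-/ : {M : LeftModule R m ℓm} (P Q : Submodule M p) (b : Fin n → LeftModule.Carrierᴹ M)
    (b∈P : ∀ j → Member P (b j)) → (∀ x → Member P x → Member (span M b) x) → GeneratedBy (P / Q) n
  generates-/ {M = M} P Q b b∈P gen = (λ j → b j , b∈P j) , λ (x , x∈P) →
    let (c , eq) = gen x x∈P in
    c , ≈ᴹ⇒difference Q (subst (LeftModule._≈ᴹ_ M x) (sym (combination-/ P Q c _)) eq)

  -- The `i`-th coordinates of the generators suffice: extend `x` by zero, expand it in the sum, and
  -- read off coordinate `i`.
  generated-⨁ : ∀ {k} (M : Fin k → LeftModule R m ℓm) → GeneratedBy (⨁ M) n → ∀ i → GeneratedBy (M i) n
  generated-⨁ M (b , gen) i = (λ j → b j i) , λ x →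
    let (c , eq) = gen (ι x) in c , M.≈ᴹ-trans
      (M.≈ᴹ-sym (ι-i x (i Fin.≟ i))) (subst (M._≈ᴹ_ (ι x i)) (combination-⨁ M i c b) (eq i))
    where
    module M = LeftModule (M i)
    -- The decision is an argument here, so that `ι-i` can match on it.
    component : M.Carrierᴹ → ∀ {j} → Dec (i ≡ j) → LeftModule.Carrierᴹ (M j)
    component x     (yes refl) = x
    component x {j} (no _)     = LeftModule.0ᴹ (M j)
    ι : M.Carrierᴹ → LeftModule.Carrierᴹ (⨁ M)
    ι x j = component x (i Fin.≟ j)
    ι-i : ∀ x (d : Dec (i ≡ i)) → component x d M.≈ᴹ x
    ι-i x (yes refl) = M.≈ᴹ-refl
    ι-i x (no i≢i)   = contradiction refl i≢i

  module _ {M : LeftModule R m ℓm} {N : LeftModule R m′ ℓm′} where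
    private
      module M = LeftModule M
      module N = LeftModule N
    open LeftModuleMorphisms M.rawLeftModule N.rawLeftModule

    combination-homo : {f : M.Carrierᴹ → N.Carrierᴹ} → IsLeftModuleHomomorphism f →
      (c : Fin n → Ring.Carrier R) (b : Fin n → M.Carrierᴹ) (b′ : Fin n → N.Carrierᴹ) →
      (∀ j → f (b j) N.≈ᴹ b′ j) → f (combination M c b) N.≈ᴹ combination N c b′
    combination-homo {n = zero}  hom c b b′ b↦ = IsLeftModuleHomomorphism.0ᴹ-homo hom
    combination-homo {n = suc n} hom c b b′ b↦ = N.≈ᴹ-trans (+ᴹ-homo _ _)
      (N.+ᴹ-cong (N.≈ᴹ-trans (*ₗ-homo _ _) (N.*ₗ-congˡ (b↦ zero)))
        (combination-homo hom (c ∘ suc) (b ∘ suc) (b′ ∘ suc) (b↦ ∘ suc)))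
      where open IsLeftModuleHomomorphism hom

    -- Preimages of the generators generate: a combination of them has the same image as `x`, and
    -- `f` is injective.
    generated-iso : {f : M.Carrierᴹ → N.Carrierᴹ} → IsLeftModuleIsomorphism f → GeneratedBy N n → GeneratedBy M n
    generated-iso {f = f} iso (b , gen) = (proj₁ ∘ preimage) , λ x →
      let (c , eq) = gen (f x) in c , injective (N.≈ᴹ-trans eq (N.≈ᴹ-sym
        (combination-homo isLeftModuleHomomorphism c _ b λ j → proj₂ (preimage j) M.≈ᴹ-refl)))
      where
      open IsLeftModuleIsomorphism iso
      preimage = surjective ∘ b

-- Subspaces and dimension over a Heyting field.

module _ {c ℓ₁ ℓ₂ m ℓm : Level} (k : HeytingField c ℓ₁ ℓ₂) (M : LeftModule (field-ring k) m ℓm) where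

  open HeytingField k
    using (_≈_; _#_; _*_; _+_; -_; 0#; 1#; tight; #⇒invertible; +-congˡ; +-identityʳ; *-congˡ; *-assoc; *-identityʳ; -‿inverseʳ)
    renaming (Carrier to K; trans to ≈-trans; sym to ≈-sym)
  open LeftModule M
  open Algebra.Properties.Ring (field-ring k) using (-0#≈0#; -‿distribˡ-*)

  private variable
    n : ℕ

  ¬#0⇒≈0 : ∀ {a} → ¬ a # 0# → a ≈ 0#
  ¬#0⇒≈0 = proj₁ (tight _ _)

  a-0≈a : ∀ a → a + - 0# ≈ a
  a-0≈a a = ≈-trans (+-congˡ -0#≈0#) (+-identityʳ a)

  #0⇒inverse : ∀ {a} → a # 0# → Σ[ a⁻¹ ∈ K ] a⁻¹ * a ≈ 1#
  #0⇒inverse {a} a#0 with a⁻¹ , inv , _ ← #⇒invertible a#0 =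
    a⁻¹ , ≈-trans (*-congˡ (≈-sym (a-0≈a a))) inv

  -- Echelon form: the first generator is the first one for which P has an element with
  -- invertible leading coefficient; otherwise, by tightness, that coefficient vanishes on P.
  subspace-generated : ∀ {p} (P : Submodule M p) (b : Fin n → Carrierᴹ) →
    ¬ ¬ (Σ[ b′ ∈ (Fin n → Carrierᴹ) ] (∀ j → Member P (b′ j)) ×
         (∀ x → Member P x → Member (span M b) x → Member (span M b′) x))
  subspace-generated {zero}  P b ¬gen = ¬gen (b , (λ ()) , λ _ _ x∈ → x∈)
  subspace-generated {suc n} P b ¬gen =
    -- `P` stays fixed while generators are dropped, so it need not lie in the span of the remaining
    -- ones; this is why the claim covers only elements of `P` that are also in the span of `b`.
    subspace-generated P (b ∘ suc) λ (b′ , b′∈P , gen) →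
    ¬¬-excluded-middle {A = Σ[ d ∈ (Fin (suc n) → K) ] Member P (combination M d b) × d zero # 0#} λ where
      -- All leading coefficients vanish, so the tail is enough; the zero vector pads the list back
      -- to length `suc n`.
      (no ∄) → ¬gen
        ( 0ᴹ ∷ᶠ b′
        , (λ { zero → P.0ᴹ-closed ; (suc j) → b′∈P j })
        , λ x x∈P (d , x≈) → tail⊆ 0ᴹ b′ (gen x x∈P
            (d ∘ suc , ≈ᴹ-trans x≈ (combination-tail M d b
              (¬#0⇒≈0 λ d₀#0 → ∄ (d , P.resp x≈ x∈P , d₀#0))))))
      (yes (e , y∈P , e₀#0)) → let (e₀⁻¹ , inv) = #0⇒inverse e₀#0
                                   y = combination M e b in ¬gen
        ( y ∷ᶠ b′
        , (λ { zero → y∈P ; (suc j) → b′∈P j })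
        , λ x x∈P (d , x≈) →
            -- With this `a` the leading coefficient of `x +ᴹ a *ₗ y` is zero, so the recursive
            -- result applies to that element of `P`; subtracting `a *ₗ y` again recovers `x`.
            let a  = - (d zero * e₀⁻¹)
                S  = span M (y ∷ᶠ b′)
                module S = Submodule S
                x′∈ : Member S (x +ᴹ a *ₗ y)
                x′∈ = tail⊆ y b′ (gen _ (P.+ᴹ-closed x∈P (P.*ₗ-closed a y∈P))
                  ( _ , ≈ᴹ-trans
                    (≈ᴹ-trans (+ᴹ-cong x≈ (≈ᴹ-sym (combination-* M a e b)))
                              (≈ᴹ-sym (combination-+ M d (λ j → a * e j) b)))
                    (combination-tail M (λ j → d j + a * e j) b (eliminate (d zero) (e zero) e₀⁻¹ inv))))
            in S.resp (x-y+y≈x M x (-ᴹ (a *ₗ y)))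
                 (S.+ᴹ-closed (S.resp (+ᴹ-congˡ (≈ᴹ-sym (-ᴹ-involutive _))) x′∈)
                    (S.-ᴹ-closed (S.*ₗ-closed a (∈span M (y ∷ᶠ b′) zero)))))
    where
    module P = Submodule P
    open Algebra.Module.Properties.LeftModule M using (-ᴹ-involutive)
    tail⊆ : ∀ y (b′ : Fin n → Carrierᴹ) {x} → Member (span M b′) x → Member (span M (y ∷ᶠ b′)) x
    tail⊆ y b′ (d , eq) = Submodule.resp (span M (y ∷ᶠ b′)) (≈ᴹ-sym eq)
      (combination-closed M (span M (y ∷ᶠ b′)) d (λ j → ∈span M (y ∷ᶠ b′) (suc j)))
    eliminate : ∀ d₀ e₀ e₀⁻¹ → e₀⁻¹ * e₀ ≈ 1# → d₀ + - (d₀ * e₀⁻¹) * e₀ ≈ 0#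
    eliminate d₀ e₀ e₀⁻¹ inv = ≈-trans
      (+-congˡ (≈-trans (≈-sym (-‿distribˡ-* (d₀ * e₀⁻¹) e₀))
        (Ring.-‿cong (field-ring k) (≈-trans (*-assoc d₀ e₀⁻¹ e₀) (≈-trans (*-congˡ inv) (*-identityʳ d₀))))))
      (-‿inverseʳ d₀)

  generated⇒hasRank : GeneratedBy M n → ¬ ¬ (Σ[ s ∈ ℕ ] HasRank M s × s ℕ.≤ n)
  generated⇒hasRank {n} (b , gen) ¬rank =
    ¬¬-excluded-middle {A = Σ[ d ∈ (Fin n → K) ] combination M d b ≈ᴹ 0ᴹ × ∃[ i ] d i # 0#} λ where
      (no ∄) → ¬rank (n , (b , record
        { independent = λ d d≈0 i → ¬#0⇒≈0 λ dᵢ#0 → ∄ (d , d≈0 , i , dᵢ#0)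
        ; spanning    = gen }) , ℕ.≤-refl)
      (yes (d , d≈0 , i , dᵢ#0)) → drop b gen d d≈0 i dᵢ#0 ¬rank
    where
    drop : ∀ {n} (b : Fin n → Carrierᴹ) → (∀ x → Member (span M b) x) →
      (d : Fin n → K) → combination M d b ≈ᴹ 0ᴹ → ∀ i → d i # 0# →
      ¬ ¬ (Σ[ s ∈ ℕ ] HasRank M s × s ℕ.≤ n)
    drop {suc n} b gen d d≈0 i dᵢ#0 = ¬¬-map (λ (s , rank , s≤n) → s , rank , ℕ.m≤n⇒m≤1+n s≤n)
      (generated⇒hasRank (b′ , λ x → let (e , eq) = gen x in
        S.resp (≈ᴹ-sym eq) (combination-closed M (span M b′) e (λ j → b∈ j (i Fin.≟ j)))))
      where
      open Algebra.Properties.AbelianGroup +ᴹ-abelianGroup using (inverseˡ-unique)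
      b′ = b ∘ punchIn i
      module S = Submodule (span M b′)
      -- The relation is solved for its `i`-th term: that term is minus the rest, and its
      -- coefficient is invertible.
      bᵢ∈ : Member (span M b′) (b i)
      bᵢ∈ = let (dᵢ⁻¹ , inv) = #0⇒inverse dᵢ#0 in
        S.resp (≈ᴹ-trans (≈ᴹ-sym (*ₗ-assoc dᵢ⁻¹ (d i) (b i))) (≈ᴹ-trans (*ₗ-congʳ inv) (*ₗ-identityˡ (b i))))
          (S.*ₗ-closed dᵢ⁻¹ (S.resp
            (≈ᴹ-sym (inverseˡ-unique _ _ (≈ᴹ-trans (≈ᴹ-sym (combination-remove M i d b)) d≈0)))
            (S.-ᴹ-closed (d ∘ punchIn i , ≈ᴹ-refl))))
      b∈ : ∀ j → Dec (i ≡ j) → Member (span M b′) (b j)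
      b∈ j (yes refl) = bᵢ∈
      b∈ j (no i≢j)   = subst (λ j → Member (span M b′) (b j)) (Fin.punchIn-punchOut i≢j) (∈span M b′ (punchOut i≢j))

-- A contraction is determined by its oriented edge lifts.

module _ {H K : Graph} where

  module _ (φc : Contraction H K) where
    private φ = proj₁ φc

    -- The sign must be recorded: over a loop, the images of the vertices do not reveal the
    -- orientation, and reversing a loop is a different morphism.
    lift : Fin (Graph.E K) → Fin (Graph.E H) × Sign
    lift f = let (e , (s , _) , _) = IsContraction.edge-fibre (proj₂ φc) f in e , s

    edge-lift : ∀ f → CellMap.edge φ (proj₁ (lift f)) ≡ inj₂ (f , proj₂ (lift f))
    edge-lift f = let (_ , (_ , eq) , _) = IsContraction.edge-fibre (proj₂ φc) f in eq

    lift-edge : ∀ {e f s} → CellMap.edge φ e ≡ inj₂ (f , s) → lift f ≡ (e , s)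
    lift-edge {e} {f} {s} eq with IsContraction.edge-fibre (proj₂ φc) f
    ... | e′ , (s′ , eq′) , unique with refl ← unique (s , eq) =
      cong (λ fs → e , proj₂ fs) (inj₂-injective (trans (sym eq′) eq))

  module _ (φc ψc : Contraction H K) (lift≗ : ∀ f → lift φc f ≡ lift ψc f) where
    private
      φ = proj₁ φc
      ψ = proj₁ ψc

    same-over : ∀ {e f s} → CellMap.edge φ e ≡ inj₂ (f , s) → CellMap.edge ψ e ≡ inj₂ (f , s)
    same-over {e} {f} {s} eq =
      subst (λ (e , s) → CellMap.edge ψ e ≡ inj₂ (f , s)) (trans (sym (lift≗ f)) (lift-edge φc eq)) (edge-lift ψc f)

  module _ {g : ℕ} (K-genus : HasGenus (whole K) g) (φc ψc : Contraction H K)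
           (lift≗ : ∀ f → lift φc f ≡ lift ψc f) where
    private
      φ = proj₁ φc
      ψ = proj₁ ψc
      module φ = CellMap φ
      module ψ = CellMap ψ

    -- If `ψ` took `e` onto an edge, `same-over` with the roles exchanged would make `φ` do so too.
    -- The two target vertices are compared only later, in `edge-determined`.
    same-collapsed : ∀ {e w} → φ.edge e ≡ inj₁ w → ∃[ w′ ] ψ.edge e ≡ inj₁ w′
    same-collapsed {e} eq with ψ.edge e in ψe
    ... | inj₁ w′ = w′ , refl
    ... | inj₂ _  = contradiction (trans (sym eq) (same-over ψc φc (sym ∘ lift≗) ψe)) λ ()

    constant-on-edge : ∀ {w u v} → Adjacent (φ.fibre w) u v → ψ.vtx u ≡ ψ.vtx v
    constant-on-edge (e , φe , refl , refl) with w′ , ψe ← same-collapsed φe =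
      trans (trans (ψ.vtx-src e) (cong (initial K) ψe)) (sym (trans (ψ.vtx-tgt e) (cong (final K) ψe)))

    constant-on-fibre : ∀ {w u v} → EqClosure (Adjacent (φ.fibre w)) u v → ψ.vtx u ≡ ψ.vtx v
    constant-on-fibre ε = refl
    constant-on-fibre (fwd a ◅ p) = trans (constant-on-edge a) (constant-on-fibre p)
    constant-on-fibre (bwd a ◅ p) = trans (sym (constant-on-edge a)) (constant-on-fibre p)

    -- The fibre of `φ` is connected through edges that `ψ` also collapses, so `ψ` is constant on
    -- it, and agreement at one vertex of the fibre spreads to all of them.
    agree-over : ∀ {v v′} → φ.vtx v′ ≡ ψ.vtx v′ → φ.vtx v ≡ φ.vtx v′ → φ.vtx v ≡ ψ.vtx v
    agree-over {v} {v′} agree same = trans same (trans agree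
      (constant-on-fibre (HasGenus.connected (IsContraction.vertex-fibre (proj₂ φc) (φ.vtx v′)) refl same)))

    -- Both maps take `e` to the same oriented edge. The ends of such edges are the vertices from
    -- which `agree-over` starts.
    agree-src : ∀ e {f s} → φ.edge e ≡ inj₂ (f , s) → φ.vtx (Graph.src H e) ≡ ψ.vtx (Graph.src H e)
    agree-src e eq = trans (trans (φ.vtx-src e) (cong (initial K) eq))
      (sym (trans (ψ.vtx-src e) (cong (initial K) (same-over φc ψc lift≗ eq))))

    agree-tgt : ∀ e {f s} → φ.edge e ≡ inj₂ (f , s) → φ.vtx (Graph.tgt H e) ≡ ψ.vtx (Graph.tgt H e)
    agree-tgt e eq = trans (trans (φ.vtx-tgt e) (cong (final K) eq))
      (sym (trans (ψ.vtx-tgt e) (cong (final K) (same-over φc ψc lift≗ eq))))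

    -- The sign tells which end of `e` lies over which end of `f`; that end is in the same fibre of
    -- `φ` as `v`.
    agree-at-ends : ∀ e {f} s → φ.edge e ≡ inj₂ (f , s) →
      ∀ {v} → φ.vtx v ≡ Graph.src K f ⊎ φ.vtx v ≡ Graph.tgt K f → φ.vtx v ≡ ψ.vtx v
    agree-at-ends e Sign.+ eq (inj₁ v↦) =
      agree-over (agree-src e eq) (trans v↦ (sym (trans (φ.vtx-src e) (cong (initial K) eq))))
    agree-at-ends e Sign.- eq (inj₁ v↦) =
      agree-over (agree-tgt e eq) (trans v↦ (sym (trans (φ.vtx-tgt e) (cong (final K) eq))))
    agree-at-ends e Sign.+ eq (inj₂ v↦) =
      agree-over (agree-tgt e eq) (trans v↦ (sym (trans (φ.vtx-tgt e) (cong (final K) eq))))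
    agree-at-ends e Sign.- eq (inj₂ v↦) =
      agree-over (agree-src e eq) (trans v↦ (sym (trans (φ.vtx-src e) (cong (initial K) eq))))

    -- Only the first step of a path from φ v to ψ v matters: if there is one, φ v is an end of an edge.
    vtx-determined : ∀ v → φ.vtx v ≡ ψ.vtx v
    -- For `w` equal to `ψ.vtx v` the two alternatives of `along` coincide, and `reduce` merges
    -- them. Leaving `w` general allows matching on the path.
    vtx-determined v = reduce (along (HasGenus.connected K-genus _ _))
      where
      along : ∀ {w} → EqClosure (Adjacent (whole K)) (φ.vtx v) w → φ.vtx v ≡ w ⊎ φ.vtx v ≡ ψ.vtx v
      along ε = inj₁ refl
      along (fwd (f , _ , src≡ , _) ◅ _) =
        inj₂ (agree-at-ends _ (proj₂ (lift φc f)) (edge-lift φc f) (inj₁ (sym src≡)))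
      along (bwd (f , _ , _ , tgt≡) ◅ _) =
        inj₂ (agree-at-ends _ (proj₂ (lift φc f)) (edge-lift φc f) (inj₂ (sym tgt≡)))

    edge-determined : ∀ e → φ.edge e ≡ ψ.edge e
    edge-determined e with φ.edge e in φe
    ... | inj₂ _ = sym (same-over φc ψc lift≗ φe)
    -- A collapsed edge goes to the image of its source, where the vertex maps already agree.
    ... | inj₁ w with w′ , ψe ← same-collapsed φe = trans (cong inj₁ (begin
      w                       ≡⟨ trans (φ.vtx-src e) (cong (initial K) φe) ⟨
      φ.vtx (Graph.src H e)   ≡⟨ vtx-determined (Graph.src H e) ⟩
      ψ.vtx (Graph.src H e)   ≡⟨ trans (ψ.vtx-src e) (cong (initial K) ψe) ⟩
      w′                      ∎)) (sym ψe)
      where open ≡-Reasoning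

    lift-injective : φc ≗ᶜ ψc
    lift-injective = vtx-determined , edge-determined

-- Counting contractions onto a graph with few edges.

signIndex : Sign → Fin 2
signIndex Sign.+ = zero
signIndex Sign.- = suc zero

signIndex-injective : ∀ {s t} → signIndex s ≡ signIndex t → s ≡ t
signIndex-injective {Sign.+} {Sign.+} _ = refl
signIndex-injective {Sign.-} {Sign.-} _ = refl

-- Each edge of the target has at most 2h oriented lifts. The `suc` keeps the base positive, so that
-- powers increase with the exponent; for h = 0 and d > 0, the zeroth power of 2h would exceed the
-- d-th.
liftCount : ℕ → ℕ → ℕ
liftCount d h = suc (h ℕ.* 2) ℕ.^ d

module _ {H K : Graph} {d : ℕ} (K≤d : ∣ K ∣ ℕ.≤ d) where

  private
    liftIndex : Contraction H K → Fin ∣ K ∣ → Fin (∣ H ∣ ℕ.* 2)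
    liftIndex φ f = combine (proj₁ (lift φ f)) (signIndex (proj₂ (lift φ f)))

    enough : (∣ H ∣ ℕ.* 2) ℕ.^ ∣ K ∣ ℕ.≤ liftCount d ∣ H ∣
    enough = ℕ.≤-trans (ℕ.^-monoˡ-≤ ∣ K ∣ (ℕ.n≤1+n _)) (ℕ.^-monoʳ-≤ (suc (∣ H ∣ ℕ.* 2)) K≤d)

  code : Contraction H K → Fin (liftCount d ∣ H ∣)
  -- Enlarging the codomain makes it independent of `K`, so that all generators of degree at most
  -- `d` share one code type.
  code φ = inject≤ (funToFin (liftIndex φ)) enough

  code-injective : ∀ {g} → HasGenus (whole K) g → ∀ {φ ψ} → code φ ≡ code ψ → φ ≗ᶜ ψ
  code-injective genus {φ} {ψ} eq = lift-injective genus φ ψ λ f →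
    let (e≡ , s≡) = Fin.combine-injective (proj₁ (lift φ f)) _ (proj₁ (lift ψ f)) _ (index≗ f)
    in cong₂ _,_ e≡ (signIndex-injective s≡)
    where
    index≗ : ∀ f → liftIndex φ f ≡ liftIndex ψ f
    index≗ f = trans (sym (Fin.finToFun-funToFin (liftIndex φ) f)) (trans
      (cong (λ t → finToFun t f) (Fin.inject≤-injective enough enough _ _ eq))
      (Fin.finToFun-funToFin (liftIndex ψ) f))

module _ {r ℓr ℓ : Level} {R : Ring r ℓr} {g d : ℕ} (N : Rep R g ℓ) (gen : GeneratedInDegree≤ d N) where

  open GeneratedInDegree≤ gen

  -- Contractions with equal codes are related by `≗ᶜ` and hence induce the same map, so the
  -- spanning family indexed by all contractions factors through finitely many codes.
  evaluation-generated : ∀ H → ¬ ¬ GeneratedBy (Rep.obj N H) (size ℕ.* liftCount d ∣ GenusGraph.graph H ∣)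
  evaluation-generated H = encoded-generated (Rep.obj N H) (λ (i , φ) → Rep.map N {H} {G i} φ (v i))
    (λ (i , φ) → combine i (code (degree i) φ)) respects (spans H)
    where
    respects : ∀ ((i , φ) (j , ψ) : Σ[ i ∈ Fin size ] Contraction (GenusGraph.graph H) (GenusGraph.graph (G i))) →
      combine i (code (degree i) φ) ≡ combine j (code (degree j) ψ) →
      Rep._≈_ N {H} (Rep.map N {H} {G i} φ (v i)) (Rep.map N {H} {G j} ψ (v j))
    respects (i , φ) (j , ψ) eq with Fin.combine-injective i _ j _ eq
    ... | refl , code≡ = Rep.map-resp N {H} {G i} {φ} {ψ}
      (code-injective (degree i) (GenusGraph.genus (G i)) {φ} {ψ} code≡) (v i)

-- The bounding polynomial.

timesOnePlusTwo_plus_ : ∀ {d} → Polynomial≤ d → ℤ → Polynomial≤ (suc d)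
timesOnePlusTwo_plus_ {zero}  (a ∷ []) b = b ℤ.+ a ∷ + 2 ℤ.* a ∷ []
-- The second argument is a carry: (1 + 2t)(a + t f) = a + t (2a + (1 + 2t) f), so 2a is handed to
-- the next coefficient.
timesOnePlusTwo_plus_ {suc d} (a ∷ f)  b = b ℤ.+ a ∷ timesOnePlusTwo f plus (+ 2 ℤ.* a)

eval-timesOnePlusTwo : ∀ {d} (f : Polynomial≤ d) b t →
  eval (timesOnePlusTwo f plus b) t ≡ b ℤ.+ (+ 1 ℤ.+ t ℤ.* + 2) ℤ.* eval f t
eval-timesOnePlusTwo {zero} (a ∷ []) b t = identity a b t
  where
  identity : ∀ a b t → (b ℤ.+ a) ℤ.+ t ℤ.* (+ 2 ℤ.* a ℤ.+ t ℤ.* 0ℤ)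
    ≡ b ℤ.+ (+ 1 ℤ.+ t ℤ.* + 2) ℤ.* (a ℤ.+ t ℤ.* 0ℤ)
  identity = solve-∀
eval-timesOnePlusTwo {suc d} (a ∷ f) b t =
  trans (cong (λ y → (b ℤ.+ a) ℤ.+ t ℤ.* y) (eval-timesOnePlusTwo f (+ 2 ℤ.* a) t)) (identity a b t (eval f t))
  where
  identity : ∀ a b t y → (b ℤ.+ a) ℤ.+ t ℤ.* (+ 2 ℤ.* a ℤ.+ (+ 1 ℤ.+ t ℤ.* + 2) ℤ.* y)
    ≡ b ℤ.+ (+ 1 ℤ.+ t ℤ.* + 2) ℤ.* (a ℤ.+ t ℤ.* y)
  identity = solve-∀

-- The coefficients of n (1 + 2t)ᵈ.
liftPolynomial : ℕ → ∀ d → Polynomial≤ d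
liftPolynomial n zero    = + n ∷ []
liftPolynomial n (suc d) = timesOnePlusTwo liftPolynomial n d plus 0ℤ

eval-liftPolynomial : ∀ n d h → eval (liftPolynomial n d) (+ h) ≡ + (n ℕ.* liftCount d h)
eval-liftPolynomial n zero h = trans
  (cong (ℤ._+_ (+ n)) (ℤ.*-zeroʳ (+ h)))
  (cong +_ (trans (ℕ.+-identityʳ n) (sym (ℕ.*-identityʳ n))))
eval-liftPolynomial n (suc d) h = begin
  eval (liftPolynomial n (suc d)) (+ h)
    ≡⟨ eval-timesOnePlusTwo (liftPolynomial n d) 0ℤ (+ h) ⟩
  0ℤ ℤ.+ (+ 1 ℤ.+ + h ℤ.* + 2) ℤ.* eval (liftPolynomial n d) (+ h)
    ≡⟨ ℤ.+-identityˡ _ ⟩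
  (+ 1 ℤ.+ + h ℤ.* + 2) ℤ.* eval (liftPolynomial n d) (+ h)
    ≡⟨ cong₂ ℤ._*_ (cong (ℤ._+_ (+ 1)) (sym (ℤ.pos-* h 2))) (eval-liftPolynomial n d h) ⟩
  + suc (h ℕ.* 2) ℤ.* + (n ℕ.* liftCount d h)
    ≡⟨ ℤ.pos-* (suc (h ℕ.* 2)) (n ℕ.* liftCount d h) ⟨
  + (suc (h ℕ.* 2) ℕ.* (n ℕ.* liftCount d h))
    ≡⟨ cong +_ (x∙yz≈y∙xz (suc (h ℕ.* 2)) n (liftCount d h)) ⟩
  + (n ℕ.* liftCount (suc d) h) ∎
  where
  open ≡-Reasoning
  open Algebra.Properties.CommutativeSemigroup ℕ.*-commutativeSemigroup using (x∙yz≈y∙xz)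

-- From small and smallish modules to the dimension bound.

graded-generated : ∀ {r ℓr ℓ} {R : Ring r ℓr} {g n} {M : Rep R g ℓ} (Φ : Filtration M) (G : GenusGraph g) →
  GeneratedBy (Rep.obj (Filtration.graded Φ) G) n → GeneratedBy (Rep.obj M G) (Filtration.length Φ ℕ.* n)
graded-generated {n = n} {M} Φ G gen =
  filtration-generated (Rep.obj M G) (λ i → sub (F i) G) (bottom G) (top G) b step
  where
  open Filtration Φ
  open Subrep
  M_G = Rep.obj M G
  _-_ : LeftModule.Carrierᴹ M_G → LeftModule.Carrierᴹ M_G → LeftModule.Carrierᴹ M_G
  x - y = LeftModule._+ᴹ_ M_G x (LeftModule.-ᴹ_ M_G y)
  pieceGen : ∀ i → GeneratedBy (sub (F (suc i)) G / sub (F (inject₁ i)) G) n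
  pieceGen = generated-⨁ (λ i → sub (F (suc i)) G / sub (F (inject₁ i)) G) gen
  b : Fin length → Fin n → LeftModule.Carrierᴹ M_G
  b i j = proj₁ (proj₁ (pieceGen i) j)
  step : ∀ i {x} → Member (sub (F (suc i)) G) x →
    Σ[ y ∈ _ ] Member (span M_G (b i)) y × Member (sub (F (inject₁ i)) G) (x - y)
  step i {x} x∈F with c , eq ← proj₂ (pieceGen i) (x , x∈F) =
    _ , (c , LeftModule.≈ᴹ-refl M_G) ,
    -- Equality in the quotient is by definition membership of the difference in `F (inject₁ i)`;
    -- only the combination has to be moved from the quotient to `M`.
    subst (λ y → Member (sub (F (inject₁ i)) G) (x - y))
      (combination-/ (sub (F (suc i)) G) (sub (F (inject₁ i)) G) c (proj₁ (pieceGen i))) eq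

-- The count for `N` at `G` survives passage to the subspace `P`, then to the quotient by `Q`, then
-- across the isomorphism with `M`. Only the subspace step uses that the scalars form a field.
small-generated : ∀ {c ℓ₁ ℓ₂ ℓ} (k : HeytingField c ℓ₁ ℓ₂) {g d} {M : Rep (field-ring k) g ℓ}
  (small : Small d M) (G : GenusGraph g) →
  ¬ ¬ GeneratedBy (Rep.obj M G)
        (GeneratedInDegree≤.size (Small.generated small) ℕ.* liftCount d ∣ GenusGraph.graph G ∣)
small-generated k {M = M} small G ¬gen = evaluation-generated N generated G λ (b , spans) →
  subspace-generated k (Rep.obj N G) (sub P G) b λ (b′ , b′∈P , spans′) →
  ¬gen (generated-iso {M = Rep.obj M G} {N = sub P G / sub Q G} (_≅_.isIsomorphism M≅P/Q G)
    (generates-/ (sub P G) (sub Q G) b′ b′∈P (λ x x∈P → spans′ x x∈P (spans x))))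
  where
  open Small small
  open Subrep

proposition4p3 : {c ℓ₁ ℓ₂ ℓ : Level} (k : HeytingField c ℓ₁ ℓ₂) (g d : ℕ)
    (M : Rep (field-ring k) g ℓ) → Smallish d M →
    Σ[ f ∈ Polynomial≤ d ] ((G : GenusGraph g) →
    ¬ ¬ (∃[ n ] (HasRank (Rep.obj M G) n × + n ≤ eval f (+ ∣ GenusGraph.graph G ∣))))
-- The scalar is the filtration length times the number of generators. Both are data independent of
-- `G`, so the polynomial is found outright and only the rank stays under double negation.
proposition4p3 k g d M (Φ , small) = liftPolynomial (length ℕ.* size) d , λ G ¬rank →
  small-generated k small G λ gen →
  generated⇒hasRank k (Rep.obj M G) (graded-generated Φ G gen) λ (n , rank , n≤) →
  ¬rank (n , rank , subst (+ n ≤_) (bound ∣ GenusGraph.graph G ∣) (ℤ.+≤+ n≤))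
  where
  open Filtration Φ using (length)
  open GeneratedInDegree≤ (Small.generated small) using (size)
  bound : ∀ h → + (length ℕ.* (size ℕ.* liftCount d h)) ≡ eval (liftPolynomial (length ℕ.* size) d) (+ h)
  bound h = trans (cong +_ (sym (ℕ.*-assoc length size (liftCount d h))))
    (sym (eval-liftPolynomial (length ℕ.* size) d h))
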